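{- For all $n,m\in\mathbb N$ and all arrows $c,d\colon A^n\to A^m$ of $\mathrm{Diag}_{PB}$ (partial Boolean circuits): if $[\![c]\!]_{PB}=[\![d]\!]_{PB}$, then $c=_{\mathbb{PB}}d$.
   Context: **Circuits.** Composition is written in diagrammatic order with $;$. For a set $\Sigma$ of generators over a single sort $A$, each with an arity $A^n$ and a coarity $A^m$ ($A^n$ is the word of length $n$; $A^0$ is the empty word, the monoidal unit, also written $1$), $\mathrm{Diag}_\Sigma$ is the strict symmetric monoidal category $(\otimes,A^0)$ freely generated by $\Sigma$: objects are the words $A^n$, arrows are well-typed terms built from generators, identities and symmetries $\sigma_{A,A}$ with $;$ and $\otimes$, modulo the laws of strict symmetric monoidal categories. A monoidal theory $\mathbb T=(\Sigma,E)$ has a set $E$ of pairs of parallel arrows of $\mathrm{Diag}_\Sigma$; $=_{\mathbb T}$ is the smallest congruence (equivalence relation closed under $;$ and $\otimes$) containing $E$. **Signatures.** $B$ has generators $\wedge\colon A^2\to A$, $\neg\colon A\to A$, $\mathsf{tt}\colon A^0\to A$, $\mathsf{copy}\colon A\to A^2$, $\mathsf{del}\colon A\to A^0$. $PB=B\cup\{\mathsf{cocopy}\colon A^2\to A\}$. Put $\mathsf{ff}:=\mathsf{tt};\neg$, $\vee:=(\neg\otimes\neg);\wedge;\neg$, $\mathsf{xnor}:=(\mathsf{copy}\otimes\mathsf{copy});(\mathrm{id}_A\otimes\sigma_{A,A}\otimes\mathrm{id}_A);(\wedge\otimes((\neg\otimes\neg);\wedge));\vee$, and $\mathsf{test}_1:=(\mathsf{tt}\otimes\mathrm{id}_A);\mathsf{cocopy};\mathsf{del}\colon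 A\to A^0$. **Theory $\mathbb{PB}$** (signature $PB$; $\mathrm{id}=\mathrm{id}_A$, $\sigma=\sigma_{A,A}$). Boolean axioms: $(\wedge\otimes\mathrm{id});\wedge=(\mathrm{id}\otimes\wedge);\wedge$; $(\mathsf{tt}\otimes\mathrm{id});\wedge=\mathrm{id}=(\mathrm{id}\otimes\mathsf{tt});\wedge$; $\sigma;\wedge=\wedge$; $(\mathrm{id}\otimes\vee);\wedge=(\mathsf{copy}\otimes\mathrm{id}\otimes\mathrm{id});(\mathrm{id}\otimes\sigma\otimes\mathrm{id});(\wedge\otimes\wedge);\vee$; $\mathsf{copy};\wedge=\mathrm{id}$; $\mathsf{copy};(\mathrm{id}\otimes\neg);\wedge=\mathsf{del};\mathsf{ff}$; $\neg;\neg=\mathrm{id}$; $(\mathsf{copy},\mathsf{del})$ is a commutative comonoid (coassociative, counital, cocommutative); $\wedge;\mathsf{copy}=(\mathsf{copy}\otimes\mathsf{copy});(\mathrm{id}\otimes\sigma\otimes\mathrm{id});(\wedge\otimes\wedge)$; $\neg;\mathsf{copy}=\mathsf{copy};(\neg\otimes\neg)$; $\mathsf{tt};\mathsf{copy}=\mathsf{tt}\otimes\mathsf{tt}$; $\wedge;\mathsf{del}=\mathsf{del}\otimes\mathsf{del}$; $\neg;\mathsf{del}=\mathsf{del}$; $\mathsf{tt};\mathsf{del}=\mathrm{id}_{A^0}$. Partiality axioms: $(\mathsf{cocopy}\otimes\mathrm{id});\mathsf{cocopy}=(\mathrm{id}\otimes\mathsf{cocopy});\mathsf{cocopy}$; $\sigma;\mathsf{cocopy}=\mathsf{cocopy}$;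 $\mathsf{copy};\mathsf{cocopy}=\mathrm{id}$; $(\mathsf{copy}\otimes\mathrm{id});(\mathrm{id}\otimes\mathsf{cocopy})=\mathsf{cocopy};\mathsf{copy}=(\mathrm{id}\otimes\mathsf{copy});(\mathsf{cocopy}\otimes\mathrm{id})$; $(\mathsf{copy}\otimes\mathsf{copy});(\mathrm{id}\otimes\sigma\otimes\mathrm{id});((\mathsf{xnor};\mathsf{test}_1)\otimes\wedge)=\mathsf{cocopy}$; $\wedge;\mathsf{test}_1=\mathsf{test}_1\otimes\mathsf{test}_1$. **Semantics.** Let $2=\{0,1\}$, $2^0=\{\bullet\}$. $\mathbf{Par}$ is the category of sets and partial functions, symmetric monoidal with $\otimes$ the cartesian product of sets, $(f_1\otimes f_2)(x_1,x_2)=(f_1(x_1),f_2(x_2))$ if both are defined, and undefined ($\bot$) otherwise. $[\![-]\!]_{PB}\colon\mathrm{Diag}_{PB}\to\mathbf{Par}$ is the symmetric monoidal functor with $A^n\mapsto 2^n$, sending $\wedge,\neg,\mathsf{tt}$ to Boolean conjunction, negation and the constant $1$, $\mathsf{copy}$ to $x\mapsto(x,x)$, $\mathsf{del}$ to $x\mapsto\bullet$, and $\mathsf{cocopy}$ to the partial function $(x,y)\mapsto x$ if $x=y$, undefined otherwise. -}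

module Defs where

open import Data.Bool.Base using (Bool; true; if_then_else_; not) renaming (_∧_ to _∧ᵇ_)
open import Data.Bool.Properties using () renaming (_≟_ to _≟ᵇ_)
open import Data.Maybe.Base using (Maybe; just; nothing; _>>=_; zipWith)
open import Data.Nat.Base using (ℕ; zero; suc; _+_)
open import Data.Nat.Properties using (+-identityʳ; +-assoc)
open import Data.Vec.Base using (Vec; []; _∷_; _++_; take; drop)
open import Relation.Binary.PropositionalEquality using (_≡_; sym; subst)
open import Relation.Nullary.Decidable using (does)

-- Over a single sort A the word Aⁿ is represented by its length n.

Signature : Set₁
Signature = ℕ → ℕ → Set

infixr 6 _⊗_
infixr 5 _⨾_

data Term (Σ : Signature) : ℕ → ℕ → Set where
  gen : ∀ {n m} → Σ n m → Term Σ n m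
  id  : ∀ n → Term Σ n n
  σ   : Term Σ 2 2
  _⨾_ : ∀ {n m k} → Term Σ n m → Term Σ m k → Term Σ n k
  _⊗_ : ∀ {n m n′ m′} → Term Σ n m → Term Σ n′ m′ → Term Σ (n + n′) (m + m′)

-- The symmetries Aⁿ ⊗ Aᵐ → Aᵐ ⊗ Aⁿ, built from σ through the coherence
-- conditions. The `subst`s only retype the domain along n + 0 ≡ n and
-- n + (1 + m) ≡ (n + 1) + m, which are identities in a strict category.

swap₁ : ∀ {Σ} n → Term Σ (n + 1) (1 + n)
swap₁ zero    = id 1
swap₁ (suc n) = (id 1 ⊗ swap₁ n) ⨾ (σ ⊗ id n)

swap : ∀ {Σ} n m → Term Σ (n + m) (m + n)
swap {Σ} n zero    = subst (λ k → Term Σ k n) (sym (+-identityʳ n)) (id n)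
swap {Σ} n (suc m) = subst (λ k → Term Σ k (suc m + n)) (+-assoc n 1 m)
                       ((swap₁ n ⊗ id m) ⨾ (id 1 ⊗ swap n m))

-- The two sides of ⊗-identityʳ and ⊗-assoc have types that are only
-- propositionally equal, so the laws (and the congruence below) relate terms
-- whose indices may differ syntactically. Related terms always have equal
-- domains and equal codomains.

data StrictSMC {Σ : Signature} :
     ∀ {n m n′ m′} → Term Σ n m → Term Σ n′ m′ → Set where
  ⨾-identityˡ : ∀ {n m} (f : Term Σ n m) → StrictSMC (id n ⨾ f) f
  ⨾-identityʳ : ∀ {n m} (f : Term Σ n m) → StrictSMC (f ⨾ id m) f
  ⨾-assoc     : ∀ {n m k l} (f : Term Σ n m) (g : Term Σ m k) (h : Term Σ k l) →
                StrictSMC ((f ⨾ g) ⨾ h) (f ⨾ (g ⨾ h))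
  ⊗-id        : ∀ n m → StrictSMC (id n ⊗ id m) (id (n + m))
  ⊗-⨾         : ∀ {n m k n′ m′ k′}
                (f : Term Σ n m) (g : Term Σ m k)
                (f′ : Term Σ n′ m′) (g′ : Term Σ m′ k′) →
                StrictSMC ((f ⨾ g) ⊗ (f′ ⨾ g′)) ((f ⊗ f′) ⨾ (g ⊗ g′))
  ⊗-identityˡ : ∀ {n m} (f : Term Σ n m) → StrictSMC (id 0 ⊗ f) f
  ⊗-identityʳ : ∀ {n m} (f : Term Σ n m) → StrictSMC (f ⊗ id 0) f
  ⊗-assoc     : ∀ {n m n′ m′ n″ m″}
                (f : Term Σ n m) (g : Term Σ n′ m′) (h : Term Σ n″ m″) →
                StrictSMC ((f ⊗ g) ⊗ h) (f ⊗ (g ⊗ h))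
  swap-invol  : ∀ n m → StrictSMC (swap n m ⨾ swap m n) (id (n + m))
  swap-nat    : ∀ {n m n′ m′} (f : Term Σ n m) (g : Term Σ n′ m′) →
                StrictSMC ((f ⊗ g) ⨾ swap m m′) (swap n n′ ⨾ (g ⊗ f))

Equations : Signature → Set₁
Equations Σ = ∀ {n m} → Term Σ n m → Term Σ n m → Set

-- The smallest congruence containing E on arrows of Diag_Σ. An arrow of Diag_Σ
-- is a term up to the strict symmetric monoidal laws, so on terms the
-- congruence is generated by these laws together with E.

data Congruence {Σ : Signature} (E : Equations Σ) :
     ∀ {n m n′ m′} → Term Σ n m → Term Σ n′ m′ → Set where
  law   : ∀ {n m n′ m′} {f : Term Σ n m} {g : Term Σ n′ m′} →
          StrictSMC f g → Congruence E f g
  axiom : ∀ {n m} {f g : Term Σ n m} → E f g → Congruence E f g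
  ≈-refl  : ∀ {n m} {f : Term Σ n m} → Congruence E f f
  ≈-sym   : ∀ {n m n′ m′} {f : Term Σ n m} {g : Term Σ n′ m′} →
            Congruence E f g → Congruence E g f
  ≈-trans : ∀ {n m n′ m′ n″ m″}
            {f : Term Σ n m} {g : Term Σ n′ m′} {h : Term Σ n″ m″} →
            Congruence E f g → Congruence E g h → Congruence E f h
  ⨾-cong  : ∀ {n m k n′ m′ k′}
            {f : Term Σ n m} {g : Term Σ m k}
            {f′ : Term Σ n′ m′} {g′ : Term Σ m′ k′} →
            Congruence E f f′ → Congruence E g g′ → Congruence E (f ⨾ g) (f′ ⨾ g′)
  ⊗-cong  : ∀ {n m k l n′ m′ k′ l′}
            {f : Term Σ n m} {g : Term Σ k l}
            {f′ : Term Σ n′ m′} {g′ : Term Σ k′ l′} →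
            Congruence E f f′ → Congruence E g g′ → Congruence E (f ⊗ g) (f′ ⊗ g′)

data PB : Signature where
  ∧ᵍ      : PB 2 1
  ¬ᵍ      : PB 1 1
  ttᵍ     : PB 0 1
  copyᵍ   : PB 1 2
  delᵍ    : PB 1 0
  cocopyᵍ : PB 2 1

Circuit : ℕ → ℕ → Set
Circuit = Term PB

id₁ : Circuit 1 1
id₁ = id 1

∧ : Circuit 2 1
∧ = gen ∧ᵍ

¬ : Circuit 1 1
¬ = gen ¬ᵍ

tt : Circuit 0 1
tt = gen ttᵍ

copy : Circuit 1 2
copy = gen copyᵍ

del : Circuit 1 0
del = gen delᵍ

cocopy : Circuit 2 1
cocopy = gen cocopyᵍ

ff : Circuit 0 1
ff = tt ⨾ ¬

∨ : Circuit 2 1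
∨ = (¬ ⊗ ¬) ⨾ ∧ ⨾ ¬

xnor : Circuit 2 1
xnor = (copy ⊗ copy) ⨾ (id₁ ⊗ σ ⊗ id₁) ⨾ (∧ ⊗ ((¬ ⊗ ¬) ⨾ ∧)) ⨾ ∨

test₁ : Circuit 1 0
test₁ = (tt ⊗ id₁) ⨾ cocopy ⨾ del

data ℙ𝔹 : Equations PB where
  ∧-assoc       : ℙ𝔹 ((∧ ⊗ id₁) ⨾ ∧) ((id₁ ⊗ ∧) ⨾ ∧)
  ∧-identityˡ   : ℙ𝔹 ((tt ⊗ id₁) ⨾ ∧) id₁
  ∧-identityʳ   : ℙ𝔹 ((id₁ ⊗ tt) ⨾ ∧) id₁
  ∧-comm        : ℙ𝔹 (σ ⨾ ∧) ∧
  ∧-distrib-∨   : ℙ𝔹 ((id₁ ⊗ ∨) ⨾ ∧)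
                     ((copy ⊗ id₁ ⊗ id₁) ⨾ (id₁ ⊗ σ ⊗ id₁) ⨾ (∧ ⊗ ∧) ⨾ ∨)
  ∧-idem        : ℙ𝔹 (copy ⨾ ∧) id₁
  ∧-complement  : ℙ𝔹 (copy ⨾ (id₁ ⊗ ¬) ⨾ ∧) (del ⨾ ff)
  ¬-invol       : ℙ𝔹 (¬ ⨾ ¬) id₁
  copy-coassoc  : ℙ𝔹 (copy ⨾ (copy ⊗ id₁)) (copy ⨾ (id₁ ⊗ copy))
  copy-counitˡ  : ℙ𝔹 (copy ⨾ (del ⊗ id₁)) id₁
  copy-counitʳ  : ℙ𝔹 (copy ⨾ (id₁ ⊗ del)) id₁
  copy-cocomm   : ℙ𝔹 (copy ⨾ σ) copy
  ∧-copy        : ℙ𝔹 (∧ ⨾ copy) ((copy ⊗ copy) ⨾ (id₁ ⊗ σ ⊗ id₁) ⨾ (∧ ⊗ ∧))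
  ¬-copy        : ℙ𝔹 (¬ ⨾ copy) (copy ⨾ (¬ ⊗ ¬))
  tt-copy       : ℙ𝔹 (tt ⨾ copy) (tt ⊗ tt)
  ∧-del         : ℙ𝔹 (∧ ⨾ del) (del ⊗ del)
  ¬-del         : ℙ𝔹 (¬ ⨾ del) del
  tt-del        : ℙ𝔹 (tt ⨾ del) (id 0)
  cocopy-assoc  : ℙ𝔹 ((cocopy ⊗ id₁) ⨾ cocopy) ((id₁ ⊗ cocopy) ⨾ cocopy)
  cocopy-comm   : ℙ𝔹 (σ ⨾ cocopy) cocopy
  special       : ℙ𝔹 (copy ⨾ cocopy) id₁
  frobeniusˡ    : ℙ𝔹 ((copy ⊗ id₁) ⨾ (id₁ ⊗ cocopy)) (cocopy ⨾ copy)
  frobeniusʳ    : ℙ𝔹 (cocopy ⨾ copy) ((id₁ ⊗ copy) ⨾ (cocopy ⊗ id₁))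
  cocopy-test   : ℙ𝔹 ((copy ⊗ copy) ⨾ (id₁ ⊗ σ ⊗ id₁) ⨾ ((xnor ⨾ test₁) ⊗ ∧)) cocopy
  ∧-test        : ℙ𝔹 (∧ ⨾ test₁) (test₁ ⊗ test₁)

infix 4 _=ℙ𝔹_

_=ℙ𝔹_ : ∀ {n m} → Circuit n m → Circuit n m → Set
_=ℙ𝔹_ = Congruence ℙ𝔹

-- Partial functions, with `nothing` for ⊥.

infix 0 _⇀_

_⇀_ : Set → Set → Set
X ⇀ Y = X → Maybe Y

⟦_⟧ᵍ : ∀ {n m} → PB n m → Vec Bool n ⇀ Vec Bool m
⟦ ∧ᵍ ⟧ᵍ      (x ∷ y ∷ []) = just ((x ∧ᵇ y) ∷ [])
⟦ ¬ᵍ ⟧ᵍ      (x ∷ [])     = just (not x ∷ [])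
⟦ ttᵍ ⟧ᵍ     []           = just (true ∷ [])
⟦ copyᵍ ⟧ᵍ   (x ∷ [])     = just (x ∷ x ∷ [])
⟦ delᵍ ⟧ᵍ    (x ∷ [])     = just []
⟦ cocopyᵍ ⟧ᵍ (x ∷ y ∷ []) = if does (x ≟ᵇ y) then just (x ∷ []) else nothing

⟦_⟧ : ∀ {n m} → Circuit n m → Vec Bool n ⇀ Vec Bool m
⟦ gen g ⟧           xs           = ⟦ g ⟧ᵍ xs
⟦ id n ⟧            xs           = just xs
⟦ σ ⟧               (x ∷ y ∷ []) = just (y ∷ x ∷ [])
⟦ c ⨾ d ⟧           xs           = ⟦ c ⟧ xs >>= ⟦ d ⟧
⟦ _⊗_ {n = n} c d ⟧ xs           = zipWith _++_ (⟦ c ⟧ (take n xs)) (⟦ d ⟧ (drop n xs))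

{-# OPTIONS --safe #-}

-- Executing a circuit symbolically on the tuple of its input variables yields a
-- list of tested conditions and a list of output values, all of them Boolean
-- expressions, and the axioms prove the circuit equal to the result of its
-- execution: cocopy-test turns every cocopy into a test, and tests, having no
-- output, commute with everything under copying. By ∧-test the conditions merge
-- into one condition q, and since copy ⨾ (test₁ ⊗ id₁) = test₁ ⨾ tt by the
-- Frobenius law, each output x may be replaced by q ∧ x. The semantics determines
-- the Boolean functions q and q ∧ x, and these determine the expressions up to
-- provable equality by completeness of the Boolean axioms.

module Submission where

open import Algebra.Bundles using (CommutativeSemigroup)
import Algebra.Properties.CommutativeSemigroup as CommutativeSemigroupProperties
open import Data.Bool.Base using (Bool; true; false; not; if_then_else_) renaming (_∧_ to _∧ᵇ_)
open import Data.Bool.Properties using () renaming (∧-assoc to ∧ᵇ-assoc)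
open import Data.Fin.Base using (Fin; zero; suc)
open import Data.List.Base using (List; []; _∷_; foldr) renaming (_++_ to _++ˡ_)
open import Data.Maybe.Base using (Maybe; just; nothing)
open import Data.Nat.Base using (ℕ; zero; suc; _+_)
open import Data.Nat.Properties using (+-identityʳ; +-assoc)
open import Data.Product.Base using (_×_; _,_; proj₁; proj₂)
open import Data.Vec.Base using (Vec; []; _∷_; _++_; map; take; drop; lookup; tabulate)
open import Data.Vec.Properties using
  (take++drop≡id; take-map; drop-map; map-++; map-∘; map-const; ∷-injective;
   lookup∘tabulate)
open import Relation.Binary.PropositionalEquality using
  (_≡_; refl; sym; trans; cong; subst; _≗_)
open import Defs

private variable
  a b c k n m l n′ m′ l′ a′ b′ : ℕ

-- Equational reasoning up to provable equality

infix 4 _≈_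
_≈_ : Circuit n m → Circuit n′ m′ → Set
_≈_ = Congruence ℙ𝔹

infix  1 begin_
infixr 2 _≈⟨_⟩_ _≈⟨_⟨_ _≡⟨_⟩_
infix  3 _∎

-- Neighbouring terms of a chain may have indices that agree only propositionally, so these
-- combinators let the indices change from step to step.
begin_ : {f : Circuit n m} {g : Circuit n′ m′} → f ≈ g → f ≈ g
begin p = p

_≈⟨_⟩_ : (f : Circuit n m) {g : Circuit n′ m′} {h : Circuit l l′} → f ≈ g → g ≈ h → f ≈ h
_ ≈⟨ p ⟩ q = ≈-trans p q

_≈⟨_⟨_ : (f : Circuit n m) {g : Circuit n′ m′} {h : Circuit l l′} → g ≈ f → g ≈ h → f ≈ h
_ ≈⟨ p ⟨ q = ≈-trans (≈-sym p) q

_≡⟨_⟩_ : (f : Circuit n m) {g : Circuit n m} {h : Circuit l l′} → f ≡ g → g ≈ h → f ≈ h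
_ ≡⟨ refl ⟩ q = q

_∎ : (f : Circuit n m) → f ≈ f
_ ∎ = ≈-refl

⨾-congˡ : {f : Circuit n m} {g : Circuit m l} {g′ : Circuit m l′} → g ≈ g′ → f ⨾ g ≈ f ⨾ g′
⨾-congˡ = ⨾-cong ≈-refl

⨾-congʳ : {f : Circuit n m} {f′ : Circuit n′ m} {g : Circuit m l} → f ≈ f′ → f ⨾ g ≈ f′ ⨾ g
⨾-congʳ p = ⨾-cong p ≈-refl

⊗-congˡ : {f : Circuit n m} {g : Circuit a b} {g′ : Circuit a′ b′} → g ≈ g′ → f ⊗ g ≈ f ⊗ g′
⊗-congˡ = ⊗-cong ≈-refl

⊗-congʳ : {f : Circuit n m} {f′ : Circuit n′ m′} {g : Circuit a b} → f ≈ f′ → f ⊗ g ≈ f′ ⊗ g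
⊗-congʳ p = ⊗-cong p ≈-refl

idˡ : {f : Circuit n m} → id n ⨾ f ≈ f
idˡ = law (⨾-identityˡ _)

idʳ : {f : Circuit n m} → f ⨾ id m ≈ f
idʳ = law (⨾-identityʳ _)

assoc : {f : Circuit n m} {g : Circuit m k} {h : Circuit k l} → (f ⨾ g) ⨾ h ≈ f ⨾ (g ⨾ h)
assoc = law (⨾-assoc _ _ _)

unitˡ : {f : Circuit n m} → id 0 ⊗ f ≈ f
unitˡ = law (⊗-identityˡ _)

unitʳ : {f : Circuit n m} → f ⊗ id 0 ≈ f
unitʳ = law (⊗-identityʳ _)

⊗-assoc≈ : {f : Circuit n m} {g : Circuit n′ m′} {h : Circuit a b} → (f ⊗ g) ⊗ h ≈ f ⊗ (g ⊗ h)
⊗-assoc≈ = law (⊗-assoc _ _ _)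

⊗-id≈ : id n ⊗ id m ≈ id (n + m)
⊗-id≈ = law (⊗-id _ _)

interchange : {f : Circuit n m} {g : Circuit m k} {f′ : Circuit n′ m′} {g′ : Circuit m′ l} →
              (f ⊗ f′) ⨾ (g ⊗ g′) ≈ (f ⨾ g) ⊗ (f′ ⨾ g′)
interchange = ≈-sym (law (⊗-⨾ _ _ _ _))

id-cong : n ≡ m → id n ≈ id m
id-cong refl = ≈-refl

-- Used to drop the transports that the definition of `swap` contains.
subst-dom : (p : n ≡ n′) (f : Circuit n m) → subst (λ i → Circuit i m) p f ≈ f
subst-dom refl f = ≈-refl

⊗-splitˡ : {f : Circuit n m} {g : Circuit n′ m′} → f ⊗ g ≈ (f ⊗ id n′) ⨾ (id m ⊗ g)
⊗-splitˡ = ≈-sym (≈-trans interchange (⊗-cong idʳ idˡ))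

⊗-splitʳ : {f : Circuit n m} {g : Circuit n′ m′} → f ⊗ g ≈ (id n ⊗ g) ⨾ (f ⊗ id m′)
⊗-splitʳ = ≈-sym (≈-trans interchange (⊗-cong idˡ idʳ))

whiskerˡ : {f : Circuit n m} {g : Circuit m l} → id a ⊗ (f ⨾ g) ≈ (id a ⊗ f) ⨾ (id a ⊗ g)
whiskerˡ = ≈-sym (≈-trans interchange (⊗-congʳ idˡ))

whiskerʳ : {f : Circuit n m} {g : Circuit m l} → (f ⨾ g) ⊗ id a ≈ (f ⊗ id a) ⨾ (g ⊗ id a)
whiskerʳ = ≈-sym (≈-trans interchange (⊗-congˡ idˡ))

id-suc-⊗ : {f : Circuit n m} → id (suc a) ⊗ f ≈ id₁ ⊗ (id a ⊗ f)
id-suc-⊗ = ≈-trans (⊗-congʳ (≈-sym ⊗-id≈)) ⊗-assoc≈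

-- Symmetries

-- ins a b is swap 1 a ⊗ id b and out a b is swap₁ a ⊗ id b, with domain and
-- codomain chosen so that the composites below typecheck without transports.
ins : ∀ a b → Circuit (suc (a + b)) (a + suc b)
ins zero    b = id (suc b)
ins (suc a) b = (σ ⊗ id (a + b)) ⨾ (id₁ ⊗ ins a b)

out : ∀ a b → Circuit (a + suc b) (suc (a + b))
out zero    b = id (suc b)
out (suc a) b = (id₁ ⊗ out a b) ⨾ (σ ⊗ id (a + b))

⊗-id-+ : {f : Circuit n m} → (f ⊗ id a) ⊗ id b ≈ f ⊗ id (a + b)
⊗-id-+ = ≈-trans ⊗-assoc≈ (⊗-congˡ ⊗-id≈)

swap₁-1 : swap₁ 1 ≈ σ
swap₁-1 = ≈-trans (⨾-cong ⊗-id≈ unitʳ) idˡ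

-- The symmetry laws are stated for `swap`; this carries them over to `σ`.
swap-1-1 : swap 1 1 ≈ σ
swap-1-1 = ≈-trans (⨾-cong (≈-trans unitʳ swap₁-1) ⊗-id≈) idʳ

σ-invol : σ ⨾ σ ≈ id 2
σ-invol = ≈-trans (⨾-cong (≈-sym swap-1-1) (≈-sym swap-1-1)) (law (swap-invol 1 1))

swap-zeroʳ : ∀ n → swap n 0 ≈ id n
swap-zeroʳ n = subst-dom (sym (+-identityʳ n)) (id n)

swap-sucʳ : ∀ n m → swap n (suc m) ≈ (swap₁ n ⊗ id m) ⨾ (id₁ ⊗ swap n m)
swap-sucʳ n m = subst-dom (+-assoc n 1 m) _

swap-zeroˡ : ∀ m → swap 0 m ≈ id m
swap-zeroˡ zero    = ≈-refl
swap-zeroˡ (suc m) = begin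
  swap 0 (suc m)                        ≈⟨ swap-sucʳ 0 m ⟩
  (id₁ ⊗ id m) ⨾ (id₁ ⊗ swap 0 m)       ≈⟨ ⨾-cong ⊗-id≈ (⊗-congˡ (swap-zeroˡ m)) ⟩
  id (suc m) ⨾ (id₁ ⊗ id m)             ≈⟨ idˡ ⟩
  id₁ ⊗ id m                            ≈⟨ ⊗-id≈ ⟩
  id (suc m)                            ∎

ins≈swap : ∀ a b → ins a b ≈ swap 1 a ⊗ id b
ins≈swap zero    b = ≈-sym ⊗-id≈
ins≈swap (suc a) b = begin
  (σ ⊗ id (a + b)) ⨾ (id₁ ⊗ ins a b)
    ≈⟨ ⨾-cong (⊗-cong (≈-sym swap₁-1) (≈-sym ⊗-id≈)) (⊗-congˡ (ins≈swap a b)) ⟩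
  (swap₁ 1 ⊗ (id a ⊗ id b)) ⨾ (id₁ ⊗ (swap 1 a ⊗ id b))
    ≈⟨ ⨾-cong ⊗-assoc≈ ⊗-assoc≈ ⟨
  ((swap₁ 1 ⊗ id a) ⊗ id b) ⨾ ((id₁ ⊗ swap 1 a) ⊗ id b)
    ≈⟨ whiskerʳ ⟨
  ((swap₁ 1 ⊗ id a) ⨾ (id₁ ⊗ swap 1 a)) ⊗ id b
    ≈⟨ ⊗-congʳ (swap-sucʳ 1 a) ⟨
  swap 1 (suc a) ⊗ id b ∎

out≈swap₁ : ∀ a b → out a b ≈ swap₁ a ⊗ id b
out≈swap₁ zero    b = ≈-sym ⊗-id≈
out≈swap₁ (suc a) b = begin
  (id₁ ⊗ out a b) ⨾ (σ ⊗ id (a + b))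
    ≈⟨ ⨾-cong (⊗-congˡ (out≈swap₁ a b)) (≈-sym ⊗-id-+) ⟩
  (id₁ ⊗ (swap₁ a ⊗ id b)) ⨾ ((σ ⊗ id a) ⊗ id b)
    ≈⟨ ⨾-congʳ ⊗-assoc≈ ⟨
  ((id₁ ⊗ swap₁ a) ⊗ id b) ⨾ ((σ ⊗ id a) ⊗ id b)
    ≈⟨ whiskerʳ ⟨
  swap₁ (suc a) ⊗ id b ∎

ins-out : ∀ a b → ins a b ⨾ out a b ≈ id (suc (a + b))
ins-out zero    b = idˡ
ins-out (suc a) b = begin
  ((σ ⊗ id (a + b)) ⨾ (id₁ ⊗ ins a b)) ⨾ ((id₁ ⊗ out a b) ⨾ (σ ⊗ id (a + b)))
    ≈⟨ ≈-trans assoc (⨾-congˡ (≈-sym assoc)) ⟩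
  (σ ⊗ id (a + b)) ⨾ (((id₁ ⊗ ins a b) ⨾ (id₁ ⊗ out a b)) ⨾ (σ ⊗ id (a + b)))
    ≈⟨ ⨾-congˡ (⨾-congʳ (≈-trans (≈-sym whiskerˡ) (≈-trans (⊗-congˡ (ins-out a b)) ⊗-id≈))) ⟩
  (σ ⊗ id (a + b)) ⨾ (id (suc (suc (a + b))) ⨾ (σ ⊗ id (a + b)))
    ≈⟨ ⨾-congˡ idˡ ⟩
  (σ ⊗ id (a + b)) ⨾ (σ ⊗ id (a + b))
    ≈⟨ whiskerʳ ⟨
  (σ ⨾ σ) ⊗ id (a + b)
    ≈⟨ ⊗-congʳ σ-invol ⟩
  id 2 ⊗ id (a + b)
    ≈⟨ ⊗-id≈ ⟩
  id (suc (suc (a + b))) ∎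

swap-sucʳ-out : ∀ n m → swap n (suc m) ≈ out n m ⨾ (id₁ ⊗ swap n m)
swap-sucʳ-out n m = ≈-trans (swap-sucʳ n m) (⨾-cong (≈-sym (out≈swap₁ n m)) ≈-refl)

-- `swap` recurses on its second argument; this is the matching recursion on the first. In the
-- induction on `m`, the crossing of the first two wires commutes with `swap n m`, which acts on the
-- others.
swap-sucˡ : ∀ n m → swap (suc n) m ≈ (id₁ ⊗ swap n m) ⨾ ins m n
swap-sucˡ n zero    = begin
  swap (suc n) 0                  ≈⟨ swap-zeroʳ (suc n) ⟩
  id (suc n)                      ≈⟨ ⊗-id≈ ⟨
  id₁ ⊗ id n                      ≈⟨ ⊗-congˡ (swap-zeroʳ n) ⟨
  id₁ ⊗ swap n 0                  ≈⟨ idʳ ⟨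
  (id₁ ⊗ swap n 0) ⨾ id (suc n)   ∎
swap-sucˡ n (suc m) = begin
  swap (suc n) (suc m)
    ≈⟨ swap-sucʳ-out (suc n) m ⟩
  ((id₁ ⊗ out n m) ⨾ (σ ⊗ id (n + m))) ⨾ (id₁ ⊗ swap (suc n) m)
    ≈⟨ ⨾-congˡ (≈-trans (⊗-congˡ (swap-sucˡ n m)) whiskerˡ) ⟩
  ((id₁ ⊗ out n m) ⨾ (σ ⊗ id (n + m))) ⨾ ((id₁ ⊗ (id₁ ⊗ swap n m)) ⨾ (id₁ ⊗ ins m n))
    ≈⟨ ≈-trans assoc (⨾-congˡ (≈-sym assoc)) ⟩
  (id₁ ⊗ out n m) ⨾ (((σ ⊗ id (n + m)) ⨾ (id₁ ⊗ (id₁ ⊗ swap n m))) ⨾ (id₁ ⊗ ins m n))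
    ≈⟨ ⨾-congˡ (⨾-congʳ (⨾-congˡ (≈-sym id-suc-⊗))) ⟩
  (id₁ ⊗ out n m) ⨾ (((σ ⊗ id (n + m)) ⨾ (id 2 ⊗ swap n m)) ⨾ (id₁ ⊗ ins m n))
    ≈⟨ ⨾-congˡ (⨾-congʳ (≈-trans (≈-sym ⊗-splitˡ) ⊗-splitʳ)) ⟩
  (id₁ ⊗ out n m) ⨾ (((id 2 ⊗ swap n m) ⨾ (σ ⊗ id (m + n))) ⨾ (id₁ ⊗ ins m n))
    ≈⟨ ⨾-congˡ (⨾-congʳ (⨾-congʳ id-suc-⊗)) ⟩
  (id₁ ⊗ out n m) ⨾ (((id₁ ⊗ (id₁ ⊗ swap n m)) ⨾ (σ ⊗ id (m + n))) ⨾ (id₁ ⊗ ins m n))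
    ≈⟨ ≈-trans (⨾-congˡ assoc) (≈-sym assoc) ⟩
  ((id₁ ⊗ out n m) ⨾ (id₁ ⊗ (id₁ ⊗ swap n m))) ⨾ ins (suc m) n
    ≈⟨ ⨾-congʳ (≈-trans (⊗-congˡ (swap-sucʳ-out n m)) whiskerˡ) ⟨
  (id₁ ⊗ swap n (suc m)) ⨾ ins (suc m) n ∎

ins-⊗ : ∀ a b c → ins a b ⊗ id c ≈ ins a (b + c)
ins-⊗ a b c = begin
  ins a b ⊗ id c             ≈⟨ ⊗-congʳ (ins≈swap a b) ⟩
  (swap 1 a ⊗ id b) ⊗ id c   ≈⟨ ⊗-id-+ ⟩
  swap 1 a ⊗ id (b + c)      ≈⟨ ins≈swap a (b + c) ⟨
  ins a (b + c)              ∎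

-- A hexagon coherence, needed to split the long crossing in the coassociativity of `dup`.
ins-+ : ∀ a b c → ins (a + b) c ≈ ins a (b + c) ⨾ (id a ⊗ ins b c)
ins-+ zero    b c = ≈-sym (≈-trans idˡ unitˡ)
ins-+ (suc a) b c = begin
  (σ ⊗ id (a + b + c)) ⨾ (id₁ ⊗ ins (a + b) c)
    ≈⟨ ⨾-cong (⊗-congˡ (id-cong (+-assoc a b c))) (≈-trans (⊗-congˡ (ins-+ a b c)) whiskerˡ) ⟩
  (σ ⊗ id (a + (b + c))) ⨾ ((id₁ ⊗ ins a (b + c)) ⨾ (id₁ ⊗ (id a ⊗ ins b c)))
    ≈⟨ assoc ⟨
  ins (suc a) (b + c) ⨾ (id₁ ⊗ (id a ⊗ ins b c))
    ≈⟨ ⨾-congˡ (≈-sym id-suc-⊗) ⟩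
  ins (suc a) (b + c) ⨾ (id (suc a) ⊗ ins b c) ∎

-- Naturality of the symmetry, with the bystanders `h` on the right. The box `g` may change the
-- number of wires, hence the general `swap c a′`.
ins-natural : (f : Circuit a a′) (g : Circuit 1 c) (h : Circuit b b′) →
              ins a b ⨾ (f ⊗ (g ⊗ h)) ≈ ((g ⊗ f) ⨾ swap c a′) ⊗ h
ins-natural {a} {a′} {c} {b} f g h = begin
  ins a b ⨾ (f ⊗ (g ⊗ h))                  ≈⟨ ⨾-cong (ins≈swap a b) (≈-sym ⊗-assoc≈) ⟩
  (swap 1 a ⊗ id b) ⨾ ((f ⊗ g) ⊗ h)        ≈⟨ interchange ⟩
  (swap 1 a ⨾ (f ⊗ g)) ⊗ (id b ⨾ h)        ≈⟨ ⊗-cong (≈-sym (law (swap-nat g f))) idˡ ⟩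
  ((g ⊗ f) ⨾ swap c a′) ⊗ h                ∎

ins-effectˡ : (f : Circuit a a′) (t : Circuit 1 0) (h : Circuit b b′) →
              ins a b ⨾ (f ⊗ (t ⊗ h)) ≈ t ⊗ (f ⊗ h)
ins-effectˡ {a′ = a′} f t h = begin
  _                              ≈⟨ ins-natural f t h ⟩
  ((t ⊗ f) ⨾ swap 0 a′) ⊗ h      ≈⟨ ⊗-congʳ (≈-trans (⨾-congˡ (swap-zeroˡ a′)) idʳ) ⟩
  (t ⊗ f) ⊗ h                    ≈⟨ ⊗-assoc≈ ⟩
  t ⊗ (f ⊗ h)                    ∎

ins-effectʳ : (t : Circuit a 0) (g : Circuit 1 c) (h : Circuit b b′) →
              ins a b ⨾ (t ⊗ (g ⊗ h)) ≈ g ⊗ (t ⊗ h)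
ins-effectʳ {c = c} t g h = begin
  _                              ≈⟨ ins-natural t g h ⟩
  ((g ⊗ t) ⨾ swap c 0) ⊗ h       ≈⟨ ⊗-congʳ (≈-trans (⨾-cong ≈-refl (swap-zeroʳ′ c)) idʳ) ⟩
  (g ⊗ t) ⊗ h                    ≈⟨ ⊗-assoc≈ ⟩
  g ⊗ (t ⊗ h)                    ∎
  where
  -- `g ⊗ t` has codomain `c + 0`, so the identity after it must carry that index for `idʳ` to
  -- apply.
  swap-zeroʳ′ : ∀ c → swap c 0 ≈ id (c + 0)
  swap-zeroʳ′ c = ≈-trans (swap-zeroʳ c) (id-cong (sym (+-identityʳ c)))

-- Copying and discarding k wires

-- The second copy of the first wire crosses the first copy of the other `k` wires, so that the
-- outputs form two consecutive blocks.
dup : ∀ k → Circuit k (k + k)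
dup zero    = id 0
dup (suc k) = (copy ⊗ dup k) ⨾ (id₁ ⊗ ins k k)

discard : ∀ k → Circuit k 0
discard zero    = id 0
discard (suc k) = del ⊗ discard k

-- Pairing as in a cartesian category, but without its projection laws: a test in one component
-- survives when the outputs are discarded.
⟨_,_⟩ : Circuit k n → Circuit k m → Circuit k (n + m)
⟨ f , g ⟩ = dup _ ⨾ (f ⊗ g)

-- The crossing inside `dup` disappears as soon as one of the two crossing bundles ends in a box
-- without outputs. Here that is the second copy of the first wire; in the next lemma it is the
-- first copy of the rest.
dup-⊗-effectʳ : (f : Circuit 1 n) (f′ : Circuit k n′) (t : Circuit 1 0) (g′ : Circuit k m′) →
                ⟨ f ⊗ f′ , t ⊗ g′ ⟩ ≈ (copy ⨾ (f ⊗ t)) ⊗ ⟨ f′ , g′ ⟩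
dup-⊗-effectʳ {k = k} f f′ t g′ = begin
  ((copy ⊗ dup k) ⨾ (id₁ ⊗ ins k k)) ⨾ ((f ⊗ f′) ⊗ (t ⊗ g′))
    ≈⟨ ≈-trans assoc (⨾-congˡ (⨾-cong ≈-refl ⊗-assoc≈)) ⟩
  (copy ⊗ dup k) ⨾ ((id₁ ⊗ ins k k) ⨾ (f ⊗ (f′ ⊗ (t ⊗ g′))))
    ≈⟨ ⨾-congˡ (≈-trans interchange (⊗-cong idˡ (ins-effectˡ f′ t g′))) ⟩
  (copy ⊗ dup k) ⨾ (f ⊗ (t ⊗ (f′ ⊗ g′)))
    ≈⟨ ⨾-cong ≈-refl (≈-sym ⊗-assoc≈) ⟩
  (copy ⊗ dup k) ⨾ ((f ⊗ t) ⊗ (f′ ⊗ g′))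
    ≈⟨ interchange ⟩
  (copy ⨾ (f ⊗ t)) ⊗ ⟨ f′ , g′ ⟩ ∎

dup-⊗-effectˡ : (f : Circuit 1 n) (t : Circuit k 0) (g : Circuit 1 m) (g′ : Circuit k m′) →
                ⟨ f ⊗ t , g ⊗ g′ ⟩ ≈ (copy ⨾ (f ⊗ g)) ⊗ ⟨ t , g′ ⟩
dup-⊗-effectˡ {k = k} f t g g′ = begin
  ((copy ⊗ dup k) ⨾ (id₁ ⊗ ins k k)) ⨾ ((f ⊗ t) ⊗ (g ⊗ g′))
    ≈⟨ ≈-trans assoc (⨾-congˡ (⨾-cong ≈-refl ⊗-assoc≈)) ⟩
  (copy ⊗ dup k) ⨾ ((id₁ ⊗ ins k k) ⨾ (f ⊗ (t ⊗ (g ⊗ g′))))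
    ≈⟨ ⨾-congˡ (≈-trans interchange (⊗-cong idˡ (ins-effectʳ t g g′))) ⟩
  (copy ⊗ dup k) ⨾ (f ⊗ (g ⊗ (t ⊗ g′)))
    ≈⟨ ⨾-cong ≈-refl (≈-sym ⊗-assoc≈) ⟩
  (copy ⊗ dup k) ⨾ ((f ⊗ g) ⊗ (t ⊗ g′))
    ≈⟨ interchange ⟩
  (copy ⨾ (f ⊗ g)) ⊗ ⟨ t , g′ ⟩ ∎

dup-counitˡ : ∀ k → ⟨ discard k , id k ⟩ ≈ id k
dup-counitˡ zero    = ≈-trans idˡ unitˡ
dup-counitˡ (suc k) = begin
  ⟨ del ⊗ discard k , id (suc k) ⟩              ≈⟨ ⨾-congˡ (⊗-congˡ ⊗-id≈) ⟨
  ⟨ del ⊗ discard k , id₁ ⊗ id k ⟩              ≈⟨ dup-⊗-effectˡ _ _ _ _ ⟩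
  (copy ⨾ (del ⊗ id₁)) ⊗ ⟨ discard k , id k ⟩   ≈⟨ ⊗-cong (axiom copy-counitˡ) (dup-counitˡ k) ⟩
  id₁ ⊗ id k                                    ≈⟨ ⊗-id≈ ⟩
  id (suc k)                                    ∎

dup-counitʳ : ∀ k → ⟨ id k , discard k ⟩ ≈ id k
dup-counitʳ zero    = ≈-trans idˡ unitˡ
dup-counitʳ (suc k) = begin
  ⟨ id (suc k) , del ⊗ discard k ⟩              ≈⟨ ⨾-congˡ (⊗-congʳ ⊗-id≈) ⟨
  ⟨ id₁ ⊗ id k , del ⊗ discard k ⟩              ≈⟨ dup-⊗-effectʳ _ _ _ _ ⟩
  (copy ⨾ (id₁ ⊗ del)) ⊗ ⟨ id k , discard k ⟩   ≈⟨ ⊗-cong (axiom copy-counitʳ) (dup-counitʳ k) ⟩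
  id₁ ⊗ id k                                    ≈⟨ ⊗-id≈ ⟩
  id (suc k)                                    ∎

-- The `ins k k` that ends `dup (suc k)` cancels the `out k k` that begins the exchange of blocks.
-- Then `copy` absorbs `σ`, `dup k` absorbs `swap k k` by induction, and the remaining `ins k k`
-- completes `dup` again.
dup-cocomm : ∀ k → dup k ⨾ swap k k ≈ dup k
dup-cocomm zero    = idˡ
dup-cocomm (suc k) = begin
  ((copy ⊗ dup k) ⨾ (id₁ ⊗ ins k k)) ⨾ swap (suc k) (suc k)
    ≈⟨ ⨾-congˡ (≈-trans (swap-sucʳ-out (suc k) k)
         (⨾-congˡ (≈-trans (⊗-congˡ (swap-sucˡ k k)) whiskerˡ))) ⟩
  ((copy ⊗ dup k) ⨾ (id₁ ⊗ ins k k)) ⨾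
    (((id₁ ⊗ out k k) ⨾ (σ ⊗ id (k + k))) ⨾ ((id₁ ⊗ (id₁ ⊗ swap k k)) ⨾ (id₁ ⊗ ins k k)))
    ≈⟨ ≈-trans assoc (⨾-congˡ (≈-trans (≈-sym assoc) (⨾-congʳ (≈-sym assoc)))) ⟩
  (copy ⊗ dup k) ⨾ ((((id₁ ⊗ ins k k) ⨾ (id₁ ⊗ out k k)) ⨾ (σ ⊗ id (k + k))) ⨾
    ((id₁ ⊗ (id₁ ⊗ swap k k)) ⨾ (id₁ ⊗ ins k k)))
    ≈⟨ ⨾-congˡ (⨾-congʳ (≈-trans (⨾-congʳ
         (≈-trans (≈-sym whiskerˡ) (≈-trans (⊗-congˡ (ins-out k k)) ⊗-id≈))) idˡ)) ⟩
  (copy ⊗ dup k) ⨾ ((σ ⊗ id (k + k)) ⨾ ((id₁ ⊗ (id₁ ⊗ swap k k)) ⨾ (id₁ ⊗ ins k k)))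
    ≈⟨ ⨾-congˡ (≈-trans (≈-sym assoc)
         (⨾-congʳ (≈-trans (⨾-congˡ (≈-sym id-suc-⊗)) (≈-sym ⊗-splitˡ)))) ⟩
  (copy ⊗ dup k) ⨾ ((σ ⊗ swap k k) ⨾ (id₁ ⊗ ins k k))
    ≈⟨ assoc ⟨
  ((copy ⊗ dup k) ⨾ (σ ⊗ swap k k)) ⨾ (id₁ ⊗ ins k k)
    ≈⟨ ⨾-congʳ (≈-trans interchange (⊗-cong (axiom copy-cocomm) (dup-cocomm k))) ⟩
  (copy ⊗ dup k) ⨾ (id₁ ⊗ ins k k) ∎

-- On both sides all copying is moved ahead of all crossings, by `slideˡ` and `slideʳ`. The copying
-- layers then agree by `copy-coassoc` and induction, and the crossing layers are the same
-- permutation.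
dup-coassoc : ∀ k → dup k ⨾ (dup k ⊗ id k) ≈ dup k ⨾ (id k ⊗ dup k)
dup-coassoc zero    = ⨾-congˡ ≈-refl
dup-coassoc (suc k) = begin
  ((copy ⊗ δ) ⨾ (id₁ ⊗ ins k k)) ⨾ (dup (suc k) ⊗ id (suc k))
    ≈⟨ ≈-trans (⨾-congˡ expandˡ) (≈-trans assoc (⨾-congˡ (≈-sym assoc))) ⟩
  (copy ⊗ δ) ⨾ (((id₁ ⊗ ins k k) ⨾ (copy ⊗ (δ ⊗ (id₁ ⊗ id k)))) ⨾ (id₁ ⊗ (ins k k ⊗ id (suc k))))
    ≈⟨ ⨾-congˡ (⨾-congʳ slideˡ) ⟩
  (copy ⊗ δ) ⨾ (((copy ⊗ (id₁ ⊗ (δ ⊗ id k))) ⨾ (id 2 ⊗ ins (k + k) k)) ⨾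
    (id₁ ⊗ (ins k k ⊗ id (suc k))))
    ≈⟨ ≈-trans (⨾-congˡ assoc) (≈-sym assoc) ⟩
  ((copy ⊗ δ) ⨾ (copy ⊗ (id₁ ⊗ (δ ⊗ id k)))) ⨾
    ((id 2 ⊗ ins (k + k) k) ⨾ (id₁ ⊗ (ins k k ⊗ id (suc k))))
    ≈⟨ ⨾-cong copies wires ⟩
  ((copy ⊗ δ) ⨾ (id₁ ⊗ (copy ⊗ (id k ⊗ δ)))) ⨾
    ((id₁ ⊗ X) ⨾ (id₁ ⊗ (id k ⊗ (id₁ ⊗ ins k k))))
    ≈⟨ ≈-trans (⨾-congˡ assoc) (≈-sym assoc) ⟨
  (copy ⊗ δ) ⨾ (((id₁ ⊗ (copy ⊗ (id k ⊗ δ))) ⨾ (id₁ ⊗ X)) ⨾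
    (id₁ ⊗ (id k ⊗ (id₁ ⊗ ins k k))))
    ≈⟨ ⨾-congˡ (⨾-congʳ slideʳ) ⟨
  (copy ⊗ δ) ⨾ (((id₁ ⊗ ins k k) ⨾ (id₁ ⊗ (id k ⊗ (copy ⊗ δ)))) ⨾
    (id₁ ⊗ (id k ⊗ (id₁ ⊗ ins k k))))
    ≈⟨ ≈-trans (⨾-congˡ expandʳ) (≈-trans assoc (⨾-congˡ (≈-sym assoc))) ⟨
  ((copy ⊗ δ) ⨾ (id₁ ⊗ ins k k)) ⨾ (id (suc k) ⊗ dup (suc k)) ∎
  where
  δ = dup k

  -- This is `swap 2 k` beside `k + k` further wires, written as two single crossings whose indices
  -- fit without transports.
  X : Circuit (2 + (k + (k + k))) (k + (2 + (k + k)))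
  X = (id₁ ⊗ ins k (k + k)) ⨾ ins k (suc (k + k))

  expandˡ : dup (suc k) ⊗ id (suc k) ≈
            (copy ⊗ (δ ⊗ (id₁ ⊗ id k))) ⨾ (id₁ ⊗ (ins k k ⊗ id (suc k)))
  expandˡ = ≈-trans whiskerʳ (⨾-cong (≈-trans ⊗-assoc≈ (⊗-congˡ (⊗-congˡ (≈-sym ⊗-id≈)))) ⊗-assoc≈)

  expandʳ : id (suc k) ⊗ dup (suc k) ≈
            (id₁ ⊗ (id k ⊗ (copy ⊗ δ))) ⨾ (id₁ ⊗ (id k ⊗ (id₁ ⊗ ins k k)))
  expandʳ = ≈-trans whiskerˡ (⨾-cong id-suc-⊗ id-suc-⊗)

  slideˡ : (id₁ ⊗ ins k k) ⨾ (copy ⊗ (δ ⊗ (id₁ ⊗ id k))) ≈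
           (copy ⊗ (id₁ ⊗ (δ ⊗ id k))) ⨾ (id 2 ⊗ ins (k + k) k)
  slideˡ = begin
    _ ≈⟨ interchange ⟩
    (id₁ ⨾ copy) ⊗ (ins k k ⨾ (δ ⊗ (id₁ ⊗ id k)))
      ≈⟨ ⊗-cong (≈-trans idˡ (≈-sym idʳ)) (ins-natural δ id₁ (id k)) ⟩
    (copy ⨾ id 2) ⊗ (((id₁ ⊗ δ) ⨾ swap 1 (k + k)) ⊗ id k)
      ≈⟨ ⊗-congˡ (≈-trans whiskerʳ (⨾-cong ⊗-assoc≈ (≈-sym (ins≈swap (k + k) k)))) ⟩
    (copy ⨾ id 2) ⊗ ((id₁ ⊗ (δ ⊗ id k)) ⨾ ins (k + k) k)
      ≈⟨ interchange ⟨
    _ ∎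

  slideʳ : (id₁ ⊗ ins k k) ⨾ (id₁ ⊗ (id k ⊗ (copy ⊗ δ))) ≈
           (id₁ ⊗ (copy ⊗ (id k ⊗ δ))) ⨾ (id₁ ⊗ X)
  slideʳ = begin
    _ ≈⟨ whiskerˡ ⟨
    id₁ ⊗ (ins k k ⨾ (id k ⊗ (copy ⊗ δ)))
      ≈⟨ ⊗-congˡ (ins-natural (id k) copy δ) ⟩
    id₁ ⊗ (((copy ⊗ id k) ⨾ swap 2 k) ⊗ δ)
      ≈⟨ ⊗-congˡ (⊗-congˡ idʳ) ⟨
    id₁ ⊗ (((copy ⊗ id k) ⨾ swap 2 k) ⊗ (δ ⨾ id (k + k)))
      ≈⟨ ⊗-congˡ interchange ⟨
    id₁ ⊗ (((copy ⊗ id k) ⊗ δ) ⨾ (swap 2 k ⊗ id (k + k)))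
      ≈⟨ ⊗-congˡ (⨾-cong ⊗-assoc≈ swap-2) ⟩
    id₁ ⊗ ((copy ⊗ (id k ⊗ δ)) ⨾ X)
      ≈⟨ whiskerˡ ⟩
    _ ∎
    where
    swap-2 : swap 2 k ⊗ id (k + k) ≈ X
    swap-2 = begin
      swap 2 k ⊗ id (k + k)
        ≈⟨ ⊗-congʳ (swap-sucˡ 1 k) ⟩
      ((id₁ ⊗ swap 1 k) ⨾ ins k 1) ⊗ id (k + k)
        ≈⟨ whiskerʳ ⟩
      ((id₁ ⊗ swap 1 k) ⊗ id (k + k)) ⨾ (ins k 1 ⊗ id (k + k))
        ≈⟨ ⨾-cong (≈-trans ⊗-assoc≈ (⊗-congˡ (≈-sym (ins≈swap k (k + k))))) (ins-⊗ k 1 (k + k)) ⟩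
      X ∎

  copies : (copy ⊗ δ) ⨾ (copy ⊗ (id₁ ⊗ (δ ⊗ id k))) ≈
           (copy ⊗ δ) ⨾ (id₁ ⊗ (copy ⊗ (id k ⊗ δ)))
  copies = begin
    _ ≈⟨ ⨾-cong ≈-refl (≈-sym ⊗-assoc≈) ⟩
    (copy ⊗ δ) ⨾ ((copy ⊗ id₁) ⊗ (δ ⊗ id k))
      ≈⟨ interchange ⟩
    (copy ⨾ (copy ⊗ id₁)) ⊗ (δ ⨾ (δ ⊗ id k))
      ≈⟨ ⊗-cong (axiom copy-coassoc) (dup-coassoc k) ⟩
    (copy ⨾ (id₁ ⊗ copy)) ⊗ (δ ⨾ (id k ⊗ δ))
      ≈⟨ interchange ⟨
    (copy ⊗ δ) ⨾ ((id₁ ⊗ copy) ⊗ (id k ⊗ δ))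
      ≈⟨ ⨾-cong ≈-refl ⊗-assoc≈ ⟩
    _ ∎

  -- The crossing of `k + k` wires splits by `ins-+`; its second half touches wires disjoint from
  -- those of the crossing after it, so the two can be exchanged.
  wires : (id 2 ⊗ ins (k + k) k) ⨾ (id₁ ⊗ (ins k k ⊗ id (suc k))) ≈
          (id₁ ⊗ X) ⨾ (id₁ ⊗ (id k ⊗ (id₁ ⊗ ins k k)))
  wires = begin
    (id 2 ⊗ ins (k + k) k) ⨾ (id₁ ⊗ (ins k k ⊗ id (suc k)))
      ≈⟨ ⨾-congʳ id-suc-⊗ ⟩
    (id₁ ⊗ (id₁ ⊗ ins (k + k) k)) ⨾ (id₁ ⊗ (ins k k ⊗ id (suc k)))
      ≈⟨ whiskerˡ ⟨
    id₁ ⊗ ((id₁ ⊗ ins (k + k) k) ⨾ (ins k k ⊗ id (suc k)))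
      ≈⟨ ⊗-congˡ (⨾-cong (≈-trans (⊗-congˡ (ins-+ k k k)) whiskerˡ) (ins-⊗ k k (suc k))) ⟩
    id₁ ⊗ (((id₁ ⊗ ins k (k + k)) ⨾ (id₁ ⊗ (id k ⊗ ins k k))) ⨾ ins k (k + suc k))
      ≈⟨ ⊗-congˡ assoc ⟩
    id₁ ⊗ ((id₁ ⊗ ins k (k + k)) ⨾ ((id₁ ⊗ (id k ⊗ ins k k)) ⨾ ins k (k + suc k)))
      ≈⟨ ⊗-congˡ (⨾-congˡ tail) ⟩
    id₁ ⊗ ((id₁ ⊗ ins k (k + k)) ⨾ (ins k (suc (k + k)) ⨾ (id k ⊗ (id₁ ⊗ ins k k))))
      ≈⟨ ⊗-congˡ assoc ⟨
    id₁ ⊗ (X ⨾ (id k ⊗ (id₁ ⊗ ins k k)))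
      ≈⟨ whiskerˡ ⟩
    (id₁ ⊗ X) ⨾ (id₁ ⊗ (id k ⊗ (id₁ ⊗ ins k k))) ∎
    where
    tail : (id₁ ⊗ (id k ⊗ ins k k)) ⨾ ins k (k + suc k) ≈
           ins k (suc (k + k)) ⨾ (id k ⊗ (id₁ ⊗ ins k k))
    tail = begin
      (id₁ ⊗ (id k ⊗ ins k k)) ⨾ ins k (k + suc k)
        ≈⟨ ⨾-cong (≈-sym ⊗-assoc≈) (ins≈swap k (k + suc k)) ⟩
      ((id₁ ⊗ id k) ⊗ ins k k) ⨾ (swap 1 k ⊗ id (k + suc k))
        ≈⟨ interchange ⟩
      ((id₁ ⊗ id k) ⨾ swap 1 k) ⊗ (ins k k ⨾ id (k + suc k))
        ≈⟨ ⊗-congˡ idʳ ⟩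
      ((id₁ ⊗ id k) ⨾ swap 1 k) ⊗ ins k k
        ≈⟨ ins-natural (id k) id₁ (ins k k) ⟨
      ins k (suc (k + k)) ⨾ (id k ⊗ (id₁ ⊗ ins k k)) ∎

-- Calculus of pairing

⟨⟩-cong : {f : Circuit k n} {f′ : Circuit k n′} {g : Circuit k m} {g′ : Circuit k m′} →
          f ≈ f′ → g ≈ g′ → ⟨ f , g ⟩ ≈ ⟨ f′ , g′ ⟩
⟨⟩-cong p q = ⨾-congˡ (⊗-cong p q)

⟨⟩-congˡ : {f : Circuit k n} {g : Circuit k m} {g′ : Circuit k m′} →
           g ≈ g′ → ⟨ f , g ⟩ ≈ ⟨ f , g′ ⟩
⟨⟩-congˡ = ⟨⟩-cong ≈-refl

⟨⟩-congʳ : {f : Circuit k n} {f′ : Circuit k n′} {g : Circuit k m} →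
           f ≈ f′ → ⟨ f , g ⟩ ≈ ⟨ f′ , g ⟩
⟨⟩-congʳ p = ⟨⟩-cong p ≈-refl

⟨⟩-⊗ : {f : Circuit k n} {g : Circuit k m} {f′ : Circuit n n′} {g′ : Circuit m m′} →
       ⟨ f , g ⟩ ⨾ (f′ ⊗ g′) ≈ ⟨ f ⨾ f′ , g ⨾ g′ ⟩
⟨⟩-⊗ = ≈-trans assoc (⨾-congˡ interchange)

⟨⟩-⊗ˡ : {f : Circuit k n} {g : Circuit k m} {f′ : Circuit n n′} →
        ⟨ f , g ⟩ ⨾ (f′ ⊗ id m) ≈ ⟨ f ⨾ f′ , g ⟩
⟨⟩-⊗ˡ = ≈-trans ⟨⟩-⊗ (⟨⟩-congˡ idʳ)

⟨⟩-⊗ʳ : {f : Circuit k n} {g : Circuit k m} {g′ : Circuit m m′} →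
        ⟨ f , g ⟩ ⨾ (id n ⊗ g′) ≈ ⟨ f , g ⨾ g′ ⟩
⟨⟩-⊗ʳ = ≈-trans ⟨⟩-⊗ (⟨⟩-congʳ idʳ)

⟨⟩-assoc : {f : Circuit k n} {g : Circuit k m} {h : Circuit k l} →
           ⟨ ⟨ f , g ⟩ , h ⟩ ≈ ⟨ f , ⟨ g , h ⟩ ⟩
⟨⟩-assoc {k = k} {f = f} {g} {h} = begin
  dup k ⨾ ((dup k ⨾ (f ⊗ g)) ⊗ h)
    ≈⟨ ⨾-congˡ (≈-trans interchange (⊗-congˡ idˡ)) ⟨
  dup k ⨾ ((dup k ⊗ id k) ⨾ ((f ⊗ g) ⊗ h))
    ≈⟨ assoc ⟨
  (dup k ⨾ (dup k ⊗ id k)) ⨾ ((f ⊗ g) ⊗ h)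
    ≈⟨ ⨾-cong (dup-coassoc k) ⊗-assoc≈ ⟩
  (dup k ⨾ (id k ⊗ dup k)) ⨾ (f ⊗ (g ⊗ h))
    ≈⟨ assoc ⟩
  dup k ⨾ ((id k ⊗ dup k) ⨾ (f ⊗ (g ⊗ h)))
    ≈⟨ ⨾-congˡ (≈-trans interchange (⊗-congʳ idˡ)) ⟩
  dup k ⨾ (f ⊗ (dup k ⨾ (g ⊗ h))) ∎

⟨⟩-swap : (f : Circuit k n) (g : Circuit k m) → ⟨ f , g ⟩ ⨾ swap n m ≈ ⟨ g , f ⟩
⟨⟩-swap {k = k} {n} {m} f g = begin
  (dup k ⨾ (f ⊗ g)) ⨾ swap n m      ≈⟨ assoc ⟩
  dup k ⨾ ((f ⊗ g) ⨾ swap n m)      ≈⟨ ⨾-congˡ (law (swap-nat f g)) ⟩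
  dup k ⨾ (swap k k ⨾ (g ⊗ f))      ≈⟨ assoc ⟨
  (dup k ⨾ swap k k) ⨾ (g ⊗ f)      ≈⟨ ⨾-congʳ (dup-cocomm k) ⟩
  dup k ⨾ (g ⊗ f)                   ∎

-- Exchanging zero wires with `n` wires is the identity, so a circuit without outputs can stand on
-- either side.
⟨⟩-effect-comm : (t : Circuit k 0) (f : Circuit k n) → ⟨ t , f ⟩ ≈ ⟨ f , t ⟩
⟨⟩-effect-comm {n = n} t f = begin
  ⟨ t , f ⟩               ≈⟨ idʳ ⟨
  ⟨ t , f ⟩ ⨾ id n        ≈⟨ ⨾-congˡ (swap-zeroˡ n) ⟨
  ⟨ t , f ⟩ ⨾ swap 0 n    ≈⟨ ⟨⟩-swap t f ⟩
  ⟨ f , t ⟩               ∎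

-- Lets all tests be collected in front: a test passes whatever stands before it.
⟨⟩-effect-shift : (t : Circuit k 0) (f : Circuit k n) (g : Circuit k m) →
                  ⟨ f , ⟨ t , g ⟩ ⟩ ≈ ⟨ t , ⟨ f , g ⟩ ⟩
⟨⟩-effect-shift t f g = begin
  ⟨ f , ⟨ t , g ⟩ ⟩   ≈⟨ ⟨⟩-assoc ⟨
  ⟨ ⟨ f , t ⟩ , g ⟩   ≈⟨ ⟨⟩-congʳ (≈-sym (⟨⟩-effect-comm t f)) ⟩
  ⟨ ⟨ t , f ⟩ , g ⟩   ≈⟨ ⟨⟩-assoc ⟩
  ⟨ t , ⟨ f , g ⟩ ⟩   ∎

⟨⟩-unitˡ : {f : Circuit k n} → ⟨ discard k , f ⟩ ≈ f
⟨⟩-unitˡ {k = k} {f = f} = begin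
  ⟨ discard k , f ⟩                    ≈⟨ ⟨⟩-congˡ idˡ ⟨
  ⟨ discard k , id k ⨾ f ⟩             ≈⟨ ⟨⟩-congʳ idʳ ⟨
  ⟨ discard k ⨾ id 0 , id k ⨾ f ⟩      ≈⟨ ⟨⟩-⊗ ⟨
  ⟨ discard k , id k ⟩ ⨾ (id 0 ⊗ f)    ≈⟨ ⨾-cong (dup-counitˡ k) unitˡ ⟩
  id k ⨾ f                             ≈⟨ idˡ ⟩
  f                                    ∎

⟨⟩-unitʳ : {f : Circuit k n} → ⟨ f , discard k ⟩ ≈ f
⟨⟩-unitʳ {f = f} = ≈-trans (≈-sym (⟨⟩-effect-comm _ f)) ⟨⟩-unitˡ

⟨⟩-σ : (f g : Circuit k 1) → ⟨ f , g ⟩ ⨾ σ ≈ ⟨ g , f ⟩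
⟨⟩-σ f g = ≈-trans (⨾-congˡ (≈-sym swap-1-1)) (⟨⟩-swap f g)

-- Naturality of `copy` at `f`. The corresponding property for `del` is, semantically, totality.
Copyable : Circuit k 1 → Set
Copyable f = f ⨾ copy ≈ ⟨ f , f ⟩

Discardable : Circuit k 1 → Set
Discardable {k} f = f ⨾ del ≈ discard k

-- The prefix common to `∧-copy`, `xnor` and `cocopy-test` duplicates a pair of wires: copying
-- yields `f`, `f`, `g`, `g`, and `σ` exchanges the middle two.
⟨⟩-spread : {f g : Circuit k 1} {f′ : Circuit 2 n} {g′ : Circuit 2 m} → Copyable f → Copyable g →
            ⟨ f , g ⟩ ⨾ ((copy ⊗ copy) ⨾ (id₁ ⊗ σ ⊗ id₁) ⨾ (f′ ⊗ g′)) ≈ ⟨ ⟨ f , g ⟩ ⨾ f′ , ⟨ f , g ⟩ ⨾ g′ ⟩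
⟨⟩-spread {f = f} {g} {f′} {g′} p q = begin
  ⟨ f , g ⟩ ⨾ ((copy ⊗ copy) ⨾ (id₁ ⊗ σ ⊗ id₁) ⨾ (f′ ⊗ g′))
    ≈⟨ assoc ⟨
  (⟨ f , g ⟩ ⨾ (copy ⊗ copy)) ⨾ ((id₁ ⊗ σ ⊗ id₁) ⨾ (f′ ⊗ g′))
    ≈⟨ ⨾-congʳ (begin
         ⟨ f , g ⟩ ⨾ (copy ⊗ copy)         ≈⟨ ≈-trans ⟨⟩-⊗ (⟨⟩-cong p q) ⟩
         ⟨ ⟨ f , f ⟩ , ⟨ g , g ⟩ ⟩         ≈⟨ ≈-trans ⟨⟩-assoc (⟨⟩-congˡ (≈-sym ⟨⟩-assoc)) ⟩
         ⟨ f , ⟨ ⟨ f , g ⟩ , g ⟩ ⟩         ∎) ⟩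
  ⟨ f , ⟨ ⟨ f , g ⟩ , g ⟩ ⟩ ⨾ ((id₁ ⊗ σ ⊗ id₁) ⨾ (f′ ⊗ g′))
    ≈⟨ assoc ⟨
  (⟨ f , ⟨ ⟨ f , g ⟩ , g ⟩ ⟩ ⨾ (id₁ ⊗ σ ⊗ id₁)) ⨾ (f′ ⊗ g′)
    ≈⟨ ⨾-congʳ (begin
         ⟨ f , ⟨ ⟨ f , g ⟩ , g ⟩ ⟩ ⨾ (id₁ ⊗ σ ⊗ id₁)
           ≈⟨ ≈-trans ⟨⟩-⊗ʳ (⟨⟩-congˡ (≈-trans ⟨⟩-⊗ˡ (⟨⟩-congʳ (⟨⟩-σ f g)))) ⟩
         ⟨ f , ⟨ ⟨ g , f ⟩ , g ⟩ ⟩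
           ≈⟨ ≈-trans (⟨⟩-congˡ ⟨⟩-assoc) (≈-sym ⟨⟩-assoc) ⟩
         ⟨ ⟨ f , g ⟩ , ⟨ f , g ⟩ ⟩ ∎) ⟩
  ⟨ ⟨ f , g ⟩ , ⟨ f , g ⟩ ⟩ ⨾ (f′ ⊗ g′)
    ≈⟨ ⟨⟩-⊗ ⟩
  ⟨ ⟨ f , g ⟩ ⨾ f′ , ⟨ f , g ⟩ ⨾ g′ ⟩ ∎

⟨⟩-weaken : (f : Circuit k n) (g : Circuit k m) → ⟨ del ⊗ f , del ⊗ g ⟩ ≈ del ⊗ ⟨ f , g ⟩
⟨⟩-weaken f g = begin
  ⟨ del ⊗ f , del ⊗ g ⟩               ≈⟨ dup-⊗-effectʳ del f del g ⟩
  (copy ⨾ (del ⊗ del)) ⊗ ⟨ f , g ⟩    ≈⟨ ⊗-congʳ copy-del-del ⟩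
  del ⊗ ⟨ f , g ⟩                     ∎
  where
  copy-del-del : copy ⨾ (del ⊗ del) ≈ del
  copy-del-del = begin
    copy ⨾ (del ⊗ del)                    ≈⟨ ⨾-congˡ ⊗-splitˡ ⟩
    copy ⨾ ((del ⊗ id₁) ⨾ (id 0 ⊗ del))   ≈⟨ assoc ⟨
    (copy ⨾ (del ⊗ id₁)) ⨾ (id 0 ⊗ del)   ≈⟨ ⨾-cong (axiom copy-counitˡ) unitˡ ⟩
    id₁ ⨾ del                             ≈⟨ idˡ ⟩
    del                                   ∎

-- Boolean expressions and symbolic execution

data Exp (k : ℕ) : Set where
  var   : Fin k → Exp k
  trueᵉ : Exp k
  _∧ᵉ_  : Exp k → Exp k → Exp k
  ¬ᵉ_   : Exp k → Exp k

infixr 5 _∨ᵉ_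
infixr 6 _∧ᵉ_
infix  7 ¬ᵉ_

-- The bodies mirror those of `∨` and `xnor`, so that executing these circuits symbolically yields
-- the same expressions by computation.
_∨ᵉ_ xnorᵉ : Exp k → Exp k → Exp k
x ∨ᵉ y = ¬ᵉ (¬ᵉ x ∧ᵉ ¬ᵉ y)
xnorᵉ x y = (x ∧ᵉ y) ∨ᵉ (¬ᵉ x ∧ᵉ ¬ᵉ y)

proj : Fin k → Circuit k 1
proj {suc k} zero    = id₁ ⊗ discard k
proj {suc k} (suc i) = del ⊗ proj i

circuit : Exp k → Circuit k 1
circuit (var i)  = proj i
circuit trueᵉ    = discard _ ⨾ tt
circuit (x ∧ᵉ y) = ⟨ circuit x , circuit y ⟩ ⨾ ∧
circuit (¬ᵉ x)   = circuit x ⨾ ¬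

proj-copyable : (i : Fin k) → Copyable (proj i)
proj-copyable {suc k} zero = begin
  (id₁ ⊗ discard k) ⨾ copy
    ≈⟨ ⨾-cong ≈-refl (≈-sym unitʳ) ⟩
  (id₁ ⊗ discard k) ⨾ (copy ⊗ id 0)
    ≈⟨ ≈-trans interchange (⊗-cong (≈-trans idˡ (≈-sym idʳ)) idʳ) ⟩
  (copy ⨾ id 2) ⊗ discard k
    ≈⟨ ⊗-cong (⨾-congˡ (≈-sym ⊗-id≈)) (≈-sym ⟨⟩-unitˡ) ⟩
  (copy ⨾ (id₁ ⊗ id₁)) ⊗ ⟨ discard k , discard k ⟩
    ≈⟨ dup-⊗-effectˡ _ _ _ _ ⟨
  ⟨ id₁ ⊗ discard k , id₁ ⊗ discard k ⟩ ∎
proj-copyable (suc i) = begin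
  (del ⊗ proj i) ⨾ copy             ≈⟨ ⨾-congˡ unitˡ ⟨
  (del ⊗ proj i) ⨾ (id 0 ⊗ copy)    ≈⟨ ≈-trans interchange (⊗-cong idʳ (proj-copyable i)) ⟩
  del ⊗ ⟨ proj i , proj i ⟩         ≈⟨ ⟨⟩-weaken _ _ ⟨
  ⟨ del ⊗ proj i , del ⊗ proj i ⟩   ∎

proj-discardable : (i : Fin k) → Discardable (proj i)
proj-discardable {suc k} zero = begin
  (id₁ ⊗ discard k) ⨾ del           ≈⟨ ⨾-cong ≈-refl (≈-sym unitʳ) ⟩
  (id₁ ⊗ discard k) ⨾ (del ⊗ id 0)  ≈⟨ ≈-trans interchange (⊗-cong idˡ idʳ) ⟩
  del ⊗ discard k                   ∎
proj-discardable {suc k} (suc i) = begin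
  (del ⊗ proj i) ⨾ del              ≈⟨ ⨾-congˡ unitˡ ⟨
  (del ⊗ proj i) ⨾ (id 0 ⊗ del)     ≈⟨ ≈-trans interchange (⊗-cong idʳ (proj-discardable i)) ⟩
  del ⊗ discard k                   ∎

-- Each Boolean operation has an axiom that moves `copy` past it.
circuit-copyable : (x : Exp k) → Copyable (circuit x)
circuit-copyable (var i)  = proj-copyable i
circuit-copyable {k} trueᵉ = begin
  (discard k ⨾ tt) ⨾ copy                 ≈⟨ ≈-trans assoc (⨾-congˡ (axiom tt-copy)) ⟩
  discard k ⨾ (tt ⊗ tt)                   ≈⟨ ⨾-congʳ (≈-sym ⟨⟩-unitˡ) ⟩
  ⟨ discard k , discard k ⟩ ⨾ (tt ⊗ tt)   ≈⟨ ⟨⟩-⊗ ⟩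
  ⟨ discard k ⨾ tt , discard k ⨾ tt ⟩     ∎
circuit-copyable (x ∧ᵉ y) = begin
  (⟨ circuit x , circuit y ⟩ ⨾ ∧) ⨾ copy
    ≈⟨ ≈-trans assoc (⨾-congˡ (axiom ∧-copy)) ⟩
  ⟨ circuit x , circuit y ⟩ ⨾ ((copy ⊗ copy) ⨾ (id₁ ⊗ σ ⊗ id₁) ⨾ (∧ ⊗ ∧))
    ≈⟨ ⟨⟩-spread (circuit-copyable x) (circuit-copyable y) ⟩
  ⟨ circuit (x ∧ᵉ y) , circuit (x ∧ᵉ y) ⟩ ∎
circuit-copyable (¬ᵉ x) = begin
  (circuit x ⨾ ¬) ⨾ copy                  ≈⟨ ≈-trans assoc (⨾-congˡ (axiom ¬-copy)) ⟩
  circuit x ⨾ (copy ⨾ (¬ ⊗ ¬))            ≈⟨ assoc ⟨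
  (circuit x ⨾ copy) ⨾ (¬ ⊗ ¬)            ≈⟨ ⨾-congʳ (circuit-copyable x) ⟩
  ⟨ circuit x , circuit x ⟩ ⨾ (¬ ⊗ ¬)     ≈⟨ ⟨⟩-⊗ ⟩
  ⟨ circuit x ⨾ ¬ , circuit x ⨾ ¬ ⟩       ∎

circuit-discardable : (x : Exp k) → Discardable (circuit x)
circuit-discardable (var i)  = proj-discardable i
circuit-discardable trueᵉ    = ≈-trans assoc (≈-trans (⨾-congˡ (axiom tt-del)) idʳ)
circuit-discardable {k} (x ∧ᵉ y) = begin
  (⟨ circuit x , circuit y ⟩ ⨾ ∧) ⨾ del       ≈⟨ ≈-trans assoc (⨾-congˡ (axiom ∧-del)) ⟩
  ⟨ circuit x , circuit y ⟩ ⨾ (del ⊗ del)     ≈⟨ ⟨⟩-⊗ ⟩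
  ⟨ circuit x ⨾ del , circuit y ⨾ del ⟩       ≈⟨ ⟨⟩-cong (circuit-discardable x) (circuit-discardable y) ⟩
  ⟨ discard k , discard k ⟩                   ≈⟨ ⟨⟩-unitˡ ⟩
  discard k                                   ∎
circuit-discardable (¬ᵉ x)   =
  ≈-trans assoc (≈-trans (⨾-congˡ (axiom ¬-del)) (circuit-discardable x))

tuple : Vec (Exp k) n → Circuit k n
tuple []       = discard _
tuple (x ∷ xs) = ⟨ circuit x , tuple xs ⟩

tuple-pair : (x y : Exp k) → tuple (x ∷ y ∷ []) ≈ ⟨ circuit x , circuit y ⟩
tuple-pair x y = ⟨⟩-congˡ ⟨⟩-unitʳ

tuple-++ : (xs : Vec (Exp k) n) (ys : Vec (Exp k) m) → tuple (xs ++ ys) ≈ ⟨ tuple xs , tuple ys ⟩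
tuple-++ []       ys = ≈-sym ⟨⟩-unitˡ
tuple-++ (x ∷ xs) ys = ≈-trans (⟨⟩-congˡ (tuple-++ xs ys)) (≈-sym ⟨⟩-assoc)

-- Stated for an arbitrary `is` so that the induction can pass to the tail of `tabulate`.
tuple-weaken : (is : Fin n → Fin k) →
               tuple (tabulate (λ j → var (suc (is j)))) ≈ del ⊗ tuple (tabulate (λ j → var (is j)))
tuple-weaken {zero}  is = ≈-refl
tuple-weaken {suc n} is = ≈-trans (⟨⟩-congˡ (tuple-weaken (λ j → is (suc j)))) (⟨⟩-weaken _ _)

variables : ∀ k → Vec (Exp k) k
variables k = tabulate var

-- Surjective pairing: the projections reassemble the identity, so a circuit can be executed on its
-- own input variables.
tuple-variables : ∀ k → tuple (variables k) ≈ id k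
tuple-variables zero    = ≈-refl
tuple-variables (suc k) = begin
  ⟨ id₁ ⊗ discard k , tuple (tabulate (λ j → var (suc j))) ⟩
    ≈⟨ ⟨⟩-congˡ (≈-trans (tuple-weaken (λ j → j)) (⊗-congˡ (tuple-variables k))) ⟩
  ⟨ id₁ ⊗ discard k , del ⊗ id k ⟩
    ≈⟨ dup-⊗-effectˡ _ _ _ _ ⟩
  (copy ⨾ (id₁ ⊗ del)) ⊗ ⟨ discard k , id k ⟩
    ≈⟨ ⊗-cong (axiom copy-counitʳ) ⟨⟩-unitˡ ⟩
  id₁ ⊗ id k
    ≈⟨ ⊗-id≈ ⟩
  id (suc k) ∎

-- Guarded circuits and execution

guard : List (Exp k) → Circuit k n → Circuit k n
guard []       f = f
guard (q ∷ qs) f = ⟨ circuit q ⨾ test₁ , guard qs f ⟩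

guard-cong : (qs : List (Exp k)) → {f : Circuit k n} {g : Circuit k m} → f ≈ g → guard qs f ≈ guard qs g
guard-cong []       p = p
guard-cong (q ∷ qs) p = ⟨⟩-congˡ (guard-cong qs p)

guard-++ : (qs rs : List (Exp k)) (f : Circuit k n) → guard (qs ++ˡ rs) f ≈ guard qs (guard rs f)
guard-++ []       rs f = ≈-refl
guard-++ (q ∷ qs) rs f = ⟨⟩-congˡ (guard-++ qs rs f)

guard-⨾ : (qs : List (Exp k)) (f : Circuit k n) (g : Circuit n m) → guard qs f ⨾ g ≈ guard qs (f ⨾ g)
guard-⨾ []       f g = ≈-refl
guard-⨾ (q ∷ qs) f g = begin
  ⟨ circuit q ⨾ test₁ , guard qs f ⟩ ⨾ g            ≈⟨ ⨾-congˡ unitˡ ⟨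
  ⟨ circuit q ⨾ test₁ , guard qs f ⟩ ⨾ (id 0 ⊗ g)   ≈⟨ ⟨⟩-⊗ʳ ⟩
  ⟨ circuit q ⨾ test₁ , guard qs f ⨾ g ⟩            ≈⟨ ⟨⟩-congˡ (guard-⨾ qs f g) ⟩
  guard (q ∷ qs) (f ⨾ g)                            ∎

guard-⟨⟩ˡ : (qs : List (Exp k)) (f : Circuit k n) (g : Circuit k m) →
            ⟨ guard qs f , g ⟩ ≈ guard qs ⟨ f , g ⟩
guard-⟨⟩ˡ []       f g = ≈-refl
guard-⟨⟩ˡ (q ∷ qs) f g = ≈-trans ⟨⟩-assoc (⟨⟩-congˡ (guard-⟨⟩ˡ qs f g))

-- Tests have no outputs, so each of them moves past `f` by `⟨⟩-effect-shift`.
guard-⟨⟩ʳ : (qs : List (Exp k)) (f : Circuit k n) (g : Circuit k m) →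
            ⟨ f , guard qs g ⟩ ≈ guard qs ⟨ f , g ⟩
guard-⟨⟩ʳ []       f g = ≈-refl
guard-⟨⟩ʳ (q ∷ qs) f g = ≈-trans (⟨⟩-effect-shift _ _ _) (⟨⟩-congˡ (guard-⟨⟩ʳ qs f g))

-- Tested conditions, then outputs.
Result : ℕ → ℕ → Set
Result k m = List (Exp k) × Vec (Exp k) m

run : Circuit n m → Vec (Exp k) n → Result k m
run (gen ∧ᵍ)      (x ∷ y ∷ []) = [] , x ∧ᵉ y ∷ []
run (gen ¬ᵍ)      (x ∷ [])     = [] , ¬ᵉ x ∷ []
run (gen ttᵍ)     []           = [] , trueᵉ ∷ []
run (gen copyᵍ)   (x ∷ [])     = [] , x ∷ x ∷ []
run (gen delᵍ)    (x ∷ [])     = [] , []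
-- As in `cocopy-test`, the output is a conjunction, which has the value of both inputs whenever
-- they agree.
run (gen cocopyᵍ) (x ∷ y ∷ []) = xnorᵉ x y ∷ [] , x ∧ᵉ y ∷ []
run (id n)        xs           = [] , xs
run σ             (x ∷ y ∷ []) = [] , y ∷ x ∷ []
run (c ⨾ d)       xs           =
  let qs , ys = run c xs ; rs , zs = run d ys in qs ++ˡ rs , zs
run (_⊗_ {n = n} c d) xs       =
  let qs , ys = run c (take n xs) ; rs , zs = run d (drop n xs) in qs ++ˡ rs , ys ++ zs

denote : Result k m → Circuit k m
denote (qs , xs) = guard qs (tuple xs)

⟨⟩-xnor : (x y : Exp k) → ⟨ circuit x , circuit y ⟩ ⨾ xnor ≈ circuit (xnorᵉ x y)
⟨⟩-xnor x y = begin
  ⟨ circuit x , circuit y ⟩ ⨾ xnor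
    ≈⟨ ⨾-congˡ (≈-trans (⨾-congˡ (≈-sym assoc)) (≈-sym assoc)) ⟩
  ⟨ circuit x , circuit y ⟩ ⨾ (((copy ⊗ copy) ⨾ ((id₁ ⊗ σ ⊗ id₁) ⨾ (∧ ⊗ ((¬ ⊗ ¬) ⨾ ∧)))) ⨾ ∨)
    ≈⟨ assoc ⟨
  (⟨ circuit x , circuit y ⟩ ⨾ ((copy ⊗ copy) ⨾ ((id₁ ⊗ σ ⊗ id₁) ⨾ (∧ ⊗ ((¬ ⊗ ¬) ⨾ ∧))))) ⨾ ∨
    ≈⟨ ⨾-congʳ (⟨⟩-spread (circuit-copyable x) (circuit-copyable y)) ⟩
  ⟨ circuit (x ∧ᵉ y) , ⟨ circuit x , circuit y ⟩ ⨾ ((¬ ⊗ ¬) ⨾ ∧) ⟩ ⨾ ∨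
    ≈⟨ ⨾-congʳ (⟨⟩-congˡ (≈-trans (≈-sym assoc) (⨾-congʳ ⟨⟩-⊗))) ⟩
  ⟨ circuit (x ∧ᵉ y) , circuit (¬ᵉ x ∧ᵉ ¬ᵉ y) ⟩ ⨾ ((¬ ⊗ ¬) ⨾ ∧ ⨾ ¬)
    ≈⟨ ≈-trans (≈-sym assoc) (≈-trans (⨾-congʳ ⟨⟩-⊗) (≈-sym assoc)) ⟩
  circuit (xnorᵉ x y) ∎

-- The inputs are arbitrary expressions rather than variables, because the second factor of a
-- composite runs on the outputs of the first.
run-sound : (c : Circuit n m) (xs : Vec (Exp k) n) → tuple xs ⨾ c ≈ denote (run c xs)
run-sound (gen ∧ᵍ) (x ∷ y ∷ []) = ≈-trans (⨾-congʳ (tuple-pair x y)) (≈-sym ⟨⟩-unitʳ)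
run-sound (gen ¬ᵍ) (x ∷ [])     = ≈-trans (⨾-congʳ ⟨⟩-unitʳ) (≈-sym ⟨⟩-unitʳ)
run-sound (gen ttᵍ) []          = ≈-sym ⟨⟩-unitʳ
run-sound (gen copyᵍ) (x ∷ [])  =
  ≈-trans (⨾-congʳ ⟨⟩-unitʳ) (≈-trans (circuit-copyable x) (≈-sym (tuple-pair x x)))
run-sound (gen delᵍ) (x ∷ [])   = ≈-trans (⨾-congʳ ⟨⟩-unitʳ) (circuit-discardable x)
run-sound (gen cocopyᵍ) (x ∷ y ∷ []) = begin
  tuple (x ∷ y ∷ []) ⨾ cocopy
    ≈⟨ ⨾-cong (tuple-pair x y) (≈-sym (axiom cocopy-test)) ⟩
  ⟨ circuit x , circuit y ⟩ ⨾ ((copy ⊗ copy) ⨾ (id₁ ⊗ σ ⊗ id₁) ⨾ ((xnor ⨾ test₁) ⊗ ∧))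
    ≈⟨ ⟨⟩-spread (circuit-copyable x) (circuit-copyable y) ⟩
  ⟨ ⟨ circuit x , circuit y ⟩ ⨾ (xnor ⨾ test₁) , circuit (x ∧ᵉ y) ⟩
    ≈⟨ ⟨⟩-cong (≈-trans (≈-sym assoc) (⨾-congʳ (⟨⟩-xnor x y))) (≈-sym ⟨⟩-unitʳ) ⟩
  denote (xnorᵉ x y ∷ [] , x ∧ᵉ y ∷ []) ∎
run-sound (id n) xs = idʳ
run-sound σ (x ∷ y ∷ []) =
  ≈-trans (⨾-congʳ (tuple-pair x y)) (≈-trans (⟨⟩-σ _ _) (≈-sym (tuple-pair y x)))
run-sound (c ⨾ d) xs with run c xs | run-sound c xs
... | qs , ys | ih with run d ys | run-sound d ys
... | rs , zs | ih′ = begin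
  tuple xs ⨾ (c ⨾ d)              ≈⟨ assoc ⟨
  (tuple xs ⨾ c) ⨾ d              ≈⟨ ⨾-congʳ ih ⟩
  guard qs (tuple ys) ⨾ d         ≈⟨ guard-⨾ qs (tuple ys) d ⟩
  guard qs (tuple ys ⨾ d)         ≈⟨ guard-cong qs ih′ ⟩
  guard qs (guard rs (tuple zs))  ≈⟨ guard-++ qs rs (tuple zs) ⟨
  guard (qs ++ˡ rs) (tuple zs)    ∎
run-sound (_⊗_ {n = n} c d) xs
  with run c (take n xs) | run-sound c (take n xs) | run d (drop n xs) | run-sound d (drop n xs)
... | qs , ys | ih | rs , zs | ih′ = begin
  tuple xs ⨾ (c ⊗ d)
    ≡⟨ cong (λ xs → tuple xs ⨾ (c ⊗ d)) (sym (take++drop≡id n xs)) ⟩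
  tuple (take n xs ++ drop n xs) ⨾ (c ⊗ d)
    ≈⟨ ⨾-congʳ (tuple-++ (take n xs) (drop n xs)) ⟩
  ⟨ tuple (take n xs) , tuple (drop n xs) ⟩ ⨾ (c ⊗ d)
    ≈⟨ ≈-trans ⟨⟩-⊗ (⟨⟩-cong ih ih′) ⟩
  ⟨ guard qs (tuple ys) , guard rs (tuple zs) ⟩
    ≈⟨ ≈-trans (guard-⟨⟩ˡ qs _ _) (guard-cong qs (guard-⟨⟩ʳ rs _ _)) ⟩
  guard qs (guard rs ⟨ tuple ys , tuple zs ⟩)
    ≈⟨ ≈-trans (guard-++ qs rs _) (guard-cong qs (guard-cong rs (tuple-++ ys zs))) ⟨
  guard (qs ++ˡ rs) (tuple (ys ++ zs)) ∎

-- Boolean completeness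

infix 4 _≃_
-- A record rather than a synonym, so that unification can recover the expressions, which `circuit`
-- would hide.
record _≃_ (x y : Exp k) : Set where
  constructor by
  field sound : circuit x ≈ circuit y
open _≃_

-- Turns an axiom on circuits into a law on expressions: by `run-sound` its two sides may be
-- executed on any inputs. Each Boolean law below is one such execution.
by-axiom : {c d : Circuit n m} → ℙ𝔹 c d → (xs : Vec (Exp k) n) → denote (run c xs) ≈ denote (run d xs)
by-axiom {c = c} {d} p xs =
  ≈-trans (≈-sym (run-sound c xs)) (≈-trans (⨾-congˡ (axiom p)) (run-sound d xs))

by-tuple : {x y : Exp k} → tuple (x ∷ []) ≈ tuple (y ∷ []) → x ≃ y
by-tuple p = by (≈-trans (≈-sym ⟨⟩-unitʳ) (≈-trans p ⟨⟩-unitʳ))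

∧ᵉ-cong : {x x′ y y′ : Exp k} → x ≃ x′ → y ≃ y′ → x ∧ᵉ y ≃ x′ ∧ᵉ y′
∧ᵉ-cong (by p) (by q) = by (⨾-congʳ (⟨⟩-cong p q))

¬ᵉ-cong : {x x′ : Exp k} → x ≃ x′ → ¬ᵉ x ≃ ¬ᵉ x′
¬ᵉ-cong (by p) = by (⨾-congʳ p)

∧ᵉ-assoc : (x y z : Exp k) → (x ∧ᵉ y) ∧ᵉ z ≃ x ∧ᵉ (y ∧ᵉ z)
∧ᵉ-assoc x y z = by-tuple (by-axiom ∧-assoc (x ∷ y ∷ z ∷ []))

∧ᵉ-comm : (x y : Exp k) → x ∧ᵉ y ≃ y ∧ᵉ x
∧ᵉ-comm x y = by-tuple (by-axiom ∧-comm (y ∷ x ∷ []))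

∧ᵉ-idem : (x : Exp k) → x ∧ᵉ x ≃ x
∧ᵉ-idem x = by-tuple (by-axiom ∧-idem (x ∷ []))

∧ᵉ-identityˡ : (x : Exp k) → trueᵉ ∧ᵉ x ≃ x
∧ᵉ-identityˡ x = by-tuple (by-axiom ∧-identityˡ (x ∷ []))

∧ᵉ-identityʳ : (x : Exp k) → x ∧ᵉ trueᵉ ≃ x
∧ᵉ-identityʳ x = by-tuple (by-axiom ∧-identityʳ (x ∷ []))

∧ᵉ-complement : (x : Exp k) → x ∧ᵉ ¬ᵉ x ≃ ¬ᵉ trueᵉ
∧ᵉ-complement x = by-tuple (by-axiom ∧-complement (x ∷ []))

¬ᵉ-invol : (x : Exp k) → ¬ᵉ ¬ᵉ x ≃ x
¬ᵉ-invol x = by-tuple (by-axiom ¬-invol (x ∷ []))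

∧ᵉ-distrib-∨ᵉ : (x y z : Exp k) → x ∧ᵉ (y ∨ᵉ z) ≃ (x ∧ᵉ y) ∨ᵉ (x ∧ᵉ z)
∧ᵉ-distrib-∨ᵉ x y z = by-tuple (by-axiom ∧-distrib-∨ (x ∷ y ∷ z ∷ []))

∧ᵉ-commutativeSemigroup : ℕ → CommutativeSemigroup _ _
∧ᵉ-commutativeSemigroup k = record
  { Carrier = Exp k
  ; _≈_     = _≃_
  ; _∙_     = _∧ᵉ_
  ; isCommutativeSemigroup = record
    { isSemigroup = record
      { isMagma = record
        { isEquivalence = record
          { refl  = by ≈-refl
          ; sym   = λ (by p) → by (≈-sym p)
          ; trans = λ (by p) (by q) → by (≈-trans p q)
          }
        ; ∙-cong = ∧ᵉ-cong
        }
      ; assoc = ∧ᵉ-assoc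
      }
    ; comm = ∧ᵉ-comm
    }
  }

module _ {k : ℕ} where
  open CommutativeSemigroup (∧ᵉ-commutativeSemigroup k) public using ()
    renaming (refl to ≃-refl; sym to ≃-sym; trans to ≃-trans)
  open CommutativeSemigroupProperties (∧ᵉ-commutativeSemigroup k) public using ()
    renaming (xy∙z≈xz∙y to ∧ᵉ-xy∙z≃xz∙y)

infix  1 begin≃_
infixr 2 _≃⟨_⟩_ _≃⟨_⟨_
infix  3 _∎≃

begin≃_ : {x y : Exp k} → x ≃ y → x ≃ y
begin≃ p = p

_≃⟨_⟩_ : (x : Exp k) {y z : Exp k} → x ≃ y → y ≃ z → x ≃ z
_ ≃⟨ p ⟩ q = ≃-trans p q

_≃⟨_⟨_ : (x : Exp k) {y z : Exp k} → y ≃ x → y ≃ z → x ≃ z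
_ ≃⟨ p ⟨ q = ≃-trans (≃-sym p) q

_∎≃ : (x : Exp k) → x ≃ x
_ ∎≃ = ≃-refl

∧ᵉ-congˡ : {x y y′ : Exp k} → y ≃ y′ → x ∧ᵉ y ≃ x ∧ᵉ y′
∧ᵉ-congˡ = ∧ᵉ-cong ≃-refl

∧ᵉ-congʳ : {x x′ y : Exp k} → x ≃ x′ → x ∧ᵉ y ≃ x′ ∧ᵉ y
∧ᵉ-congʳ p = ∧ᵉ-cong p ≃-refl

constant : Bool → Exp k
constant true  = trueᵉ
constant false = ¬ᵉ trueᵉ

∧ᵉ-zeroˡ : (x : Exp k) → ¬ᵉ trueᵉ ∧ᵉ x ≃ ¬ᵉ trueᵉ
∧ᵉ-zeroˡ x = begin≃
  ¬ᵉ trueᵉ ∧ᵉ x        ≃⟨ ∧ᵉ-congʳ (∧ᵉ-complement x) ⟨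
  (x ∧ᵉ ¬ᵉ x) ∧ᵉ x     ≃⟨ ∧ᵉ-xy∙z≃xz∙y x (¬ᵉ x) x ⟩
  (x ∧ᵉ x) ∧ᵉ ¬ᵉ x     ≃⟨ ∧ᵉ-congʳ (∧ᵉ-idem x) ⟩
  x ∧ᵉ ¬ᵉ x            ≃⟨ ∧ᵉ-complement x ⟩
  ¬ᵉ trueᵉ             ∎≃

∧ᵉ-zeroʳ : (x : Exp k) → x ∧ᵉ ¬ᵉ trueᵉ ≃ ¬ᵉ trueᵉ
∧ᵉ-zeroʳ x = ≃-trans (∧ᵉ-comm x _) (∧ᵉ-zeroˡ x)

∨ᵉ-identityˡ : (x : Exp k) → ¬ᵉ trueᵉ ∨ᵉ x ≃ x
∨ᵉ-identityˡ x = begin≃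
  ¬ᵉ (¬ᵉ ¬ᵉ trueᵉ ∧ᵉ ¬ᵉ x)   ≃⟨ ¬ᵉ-cong (∧ᵉ-congʳ (¬ᵉ-invol trueᵉ)) ⟩
  ¬ᵉ (trueᵉ ∧ᵉ ¬ᵉ x)         ≃⟨ ¬ᵉ-cong (∧ᵉ-identityˡ (¬ᵉ x)) ⟩
  ¬ᵉ ¬ᵉ x                    ≃⟨ ¬ᵉ-invol x ⟩
  x                          ∎≃

∨ᵉ-complement : (x : Exp k) → x ∨ᵉ ¬ᵉ x ≃ trueᵉ
∨ᵉ-complement x = ≃-trans (¬ᵉ-cong (∧ᵉ-complement (¬ᵉ x))) (¬ᵉ-invol trueᵉ)

-- Complement relative to `x`. It lets an equation known only below `x` be applied under a negation,
-- as the negation case of `minterm-eval` requires.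
∧ᵉ-¬ᵉ-relative : (x y : Exp k) → x ∧ᵉ ¬ᵉ (x ∧ᵉ y) ≃ x ∧ᵉ ¬ᵉ y
∧ᵉ-¬ᵉ-relative x y = begin≃
  x ∧ᵉ ¬ᵉ (x ∧ᵉ y)
    ≃⟨ ∧ᵉ-congˡ (¬ᵉ-cong (∧ᵉ-cong (¬ᵉ-invol x) (¬ᵉ-invol y))) ⟨
  x ∧ᵉ (¬ᵉ x ∨ᵉ ¬ᵉ y)
    ≃⟨ ∧ᵉ-distrib-∨ᵉ x (¬ᵉ x) (¬ᵉ y) ⟩
  (x ∧ᵉ ¬ᵉ x) ∨ᵉ (x ∧ᵉ ¬ᵉ y)
    ≃⟨ ¬ᵉ-cong (∧ᵉ-congʳ (¬ᵉ-cong (∧ᵉ-complement x))) ⟩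
  ¬ᵉ trueᵉ ∨ᵉ (x ∧ᵉ ¬ᵉ y)
    ≃⟨ ∨ᵉ-identityˡ _ ⟩
  x ∧ᵉ ¬ᵉ y ∎≃

constant-∧ : ∀ p q → constant {k} p ∧ᵉ constant q ≃ constant (p ∧ᵇ q)
constant-∧ true  q = ∧ᵉ-identityˡ (constant q)
constant-∧ false q = ∧ᵉ-zeroˡ (constant q)

constant-¬ : ∀ p → ¬ᵉ constant {k} p ≃ constant (not p)
constant-¬ true  = ≃-refl
constant-¬ false = ¬ᵉ-invol trueᵉ

-- Minterms and evaluation

literal : Exp k → Bool → Exp k
literal x true  = x
literal x false = ¬ᵉ x

minterm : Vec (Exp k) n → Vec Bool n → Exp k
minterm []       []      = trueᵉ
minterm (x ∷ xs) (p ∷ ρ) = literal x p ∧ᵉ minterm xs ρ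

literal-∧ : ∀ (x : Exp k) p → literal x p ∧ᵉ x ≃ literal x p ∧ᵉ constant p
literal-∧ x true  = ≃-trans (∧ᵉ-idem x) (≃-sym (∧ᵉ-identityʳ x))
-- For the negative literal both sides are provably false.
literal-∧ x false = begin≃
  ¬ᵉ x ∧ᵉ x           ≃⟨ ∧ᵉ-comm (¬ᵉ x) x ⟩
  x ∧ᵉ ¬ᵉ x           ≃⟨ ∧ᵉ-complement x ⟩
  ¬ᵉ trueᵉ            ≃⟨ ∧ᵉ-zeroʳ (¬ᵉ x) ⟨
  ¬ᵉ x ∧ᵉ ¬ᵉ trueᵉ    ∎≃

-- Shannon expansion: any `y` is the disjunction of its parts below `x` and below the negation of
-- `x`.
literal-cases : {x y z : Exp k} → (∀ p → literal x p ∧ᵉ y ≃ literal x p ∧ᵉ z) → y ≃ z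
literal-cases {x = x} {y} {z} eq = begin≃
  y                            ≃⟨ expand y ⟩
  (x ∧ᵉ y) ∨ᵉ (¬ᵉ x ∧ᵉ y)      ≃⟨ ¬ᵉ-cong (∧ᵉ-cong (¬ᵉ-cong (eq true)) (¬ᵉ-cong (eq false))) ⟩
  (x ∧ᵉ z) ∨ᵉ (¬ᵉ x ∧ᵉ z)      ≃⟨ expand z ⟨
  z                            ∎≃
  where
  expand : ∀ y → y ≃ (x ∧ᵉ y) ∨ᵉ (¬ᵉ x ∧ᵉ y)
  expand y = begin≃
    y                           ≃⟨ ∧ᵉ-identityʳ y ⟨
    y ∧ᵉ trueᵉ                  ≃⟨ ∧ᵉ-congˡ (∨ᵉ-complement x) ⟨
    y ∧ᵉ (x ∨ᵉ ¬ᵉ x)            ≃⟨ ∧ᵉ-distrib-∨ᵉ y x (¬ᵉ x) ⟩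
    (y ∧ᵉ x) ∨ᵉ (y ∧ᵉ ¬ᵉ x)     ≃⟨ ¬ᵉ-cong (∧ᵉ-cong (¬ᵉ-cong (∧ᵉ-comm y x)) (¬ᵉ-cong (∧ᵉ-comm y (¬ᵉ x)))) ⟩
    (x ∧ᵉ y) ∨ᵉ (¬ᵉ x ∧ᵉ y)     ∎≃

minterm-cases : (xs : Vec (Exp k) n) {y z : Exp k} →
                (∀ ρ → minterm xs ρ ∧ᵉ y ≃ minterm xs ρ ∧ᵉ z) → y ≃ z
minterm-cases []       {y} {z} eq = ≃-trans (≃-sym (∧ᵉ-identityˡ y)) (≃-trans (eq []) (∧ᵉ-identityˡ z))
minterm-cases (x ∷ xs) {y} {z} eq = literal-cases λ p → minterm-cases xs λ ρ → begin≃
  minterm xs ρ ∧ᵉ literal x p ∧ᵉ y        ≃⟨ regroup p ρ y ⟩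
  minterm (x ∷ xs) (p ∷ ρ) ∧ᵉ y           ≃⟨ eq (p ∷ ρ) ⟩
  minterm (x ∷ xs) (p ∷ ρ) ∧ᵉ z           ≃⟨ regroup p ρ z ⟨
  minterm xs ρ ∧ᵉ literal x p ∧ᵉ z        ∎≃
  where
  regroup : ∀ p ρ y → minterm xs ρ ∧ᵉ literal x p ∧ᵉ y ≃ minterm (x ∷ xs) (p ∷ ρ) ∧ᵉ y
  regroup p ρ y = ≃-trans (≃-sym (∧ᵉ-assoc _ _ _)) (∧ᵉ-congʳ (∧ᵉ-comm _ _))

minterm-lookup : ∀ (xs : Vec (Exp k) n) ρ i →
                 minterm xs ρ ∧ᵉ lookup xs i ≃ minterm xs ρ ∧ᵉ constant (lookup ρ i)
minterm-lookup (x ∷ xs) (p ∷ ρ) zero    = begin≃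
  (literal x p ∧ᵉ minterm xs ρ) ∧ᵉ x            ≃⟨ ∧ᵉ-xy∙z≃xz∙y _ _ _ ⟩
  (literal x p ∧ᵉ x) ∧ᵉ minterm xs ρ            ≃⟨ ∧ᵉ-congʳ (literal-∧ x p) ⟩
  (literal x p ∧ᵉ constant p) ∧ᵉ minterm xs ρ   ≃⟨ ∧ᵉ-xy∙z≃xz∙y _ _ _ ⟩
  (literal x p ∧ᵉ minterm xs ρ) ∧ᵉ constant p   ∎≃
minterm-lookup (x ∷ xs) (p ∷ ρ) (suc i) =
  ≃-trans (∧ᵉ-assoc _ _ _) (≃-trans (∧ᵉ-congˡ (minterm-lookup xs ρ i)) (≃-sym (∧ᵉ-assoc _ _ _)))

eval : Vec Bool k → Exp k → Bool
eval ρ (var i)  = lookup ρ i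
eval ρ trueᵉ    = true
eval ρ (x ∧ᵉ y) = eval ρ x ∧ᵇ eval ρ y
eval ρ (¬ᵉ x)   = not (eval ρ x)

-- Below a minterm every variable is a constant by `minterm-lookup`, and constants propagate through
-- the connectives.
minterm-eval : (ρ : Vec Bool k) (x : Exp k) →
               minterm (variables k) ρ ∧ᵉ x ≃ minterm (variables k) ρ ∧ᵉ constant (eval ρ x)
minterm-eval {k} ρ = go
  where
  μ = minterm (variables k) ρ

  go : ∀ x → μ ∧ᵉ x ≃ μ ∧ᵉ constant (eval ρ x)
  -- `lookup (variables k) i` equals `var i` only propositionally, hence the transport.
  go (var i) = subst (λ x → μ ∧ᵉ x ≃ μ ∧ᵉ constant (lookup ρ i)) (lookup∘tabulate var i)
                 (minterm-lookup (variables k) ρ i)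
  go trueᵉ = ≃-refl
  go (x ∧ᵉ y) = begin≃
    μ ∧ᵉ x ∧ᵉ y                                         ≃⟨ ∧ᵉ-assoc _ _ _ ⟨
    (μ ∧ᵉ x) ∧ᵉ y                                       ≃⟨ ∧ᵉ-congʳ (go x) ⟩
    -- The single `μ` is moved next to `y`, so that it serves for the second conjunct too.
    (μ ∧ᵉ constant (eval ρ x)) ∧ᵉ y                     ≃⟨ ∧ᵉ-xy∙z≃xz∙y _ _ _ ⟩
    (μ ∧ᵉ y) ∧ᵉ constant (eval ρ x)                     ≃⟨ ∧ᵉ-congʳ (go y) ⟩
    (μ ∧ᵉ constant (eval ρ y)) ∧ᵉ constant (eval ρ x)   ≃⟨ ∧ᵉ-xy∙z≃xz∙y _ _ _ ⟩
    (μ ∧ᵉ constant (eval ρ x)) ∧ᵉ constant (eval ρ y)   ≃⟨ ∧ᵉ-assoc _ _ _ ⟩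
    μ ∧ᵉ constant (eval ρ x) ∧ᵉ constant (eval ρ y)     ≃⟨ ∧ᵉ-congˡ (constant-∧ (eval ρ x) (eval ρ y)) ⟩
    μ ∧ᵉ constant (eval ρ x ∧ᵇ eval ρ y)                ∎≃
  go (¬ᵉ x) = begin≃
    μ ∧ᵉ ¬ᵉ x                            ≃⟨ ∧ᵉ-¬ᵉ-relative μ x ⟨
    μ ∧ᵉ ¬ᵉ (μ ∧ᵉ x)                     ≃⟨ ∧ᵉ-congˡ (¬ᵉ-cong (go x)) ⟩
    μ ∧ᵉ ¬ᵉ (μ ∧ᵉ constant (eval ρ x))   ≃⟨ ∧ᵉ-¬ᵉ-relative μ _ ⟩
    μ ∧ᵉ ¬ᵉ constant (eval ρ x)          ≃⟨ ∧ᵉ-congˡ (constant-¬ (eval ρ x)) ⟩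
    μ ∧ᵉ constant (not (eval ρ x))       ∎≃

-- The minterms over all variables exhaust the cases, and below each of them an expression is
-- provably the constant that `eval` gives.
exp-complete : (x y : Exp k) → (∀ ρ → eval ρ x ≡ eval ρ y) → x ≃ y
exp-complete {k} x y eq = minterm-cases (variables k) λ ρ → begin≃
  minterm (variables k) ρ ∧ᵉ x                      ≃⟨ minterm-eval ρ x ⟩
  minterm (variables k) ρ ∧ᵉ constant (eval ρ x)    ≃⟨ subst (λ p → _ ≃ _ ∧ᵉ constant p) (eq ρ) ≃-refl ⟩
  minterm (variables k) ρ ∧ᵉ constant (eval ρ y)    ≃⟨ minterm-eval ρ y ⟨
  minterm (variables k) ρ ∧ᵉ y                      ∎≃

tuple-complete : (xs ys : Vec (Exp k) n) → (∀ ρ → map (eval ρ) xs ≡ map (eval ρ) ys) → tuple xs ≈ tuple ys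
tuple-complete []       []       eq = ≈-refl
tuple-complete (x ∷ xs) (y ∷ ys) eq = ⟨⟩-cong
  (sound (exp-complete x y λ ρ → proj₁ (∷-injective (eq ρ))))
  (tuple-complete xs ys λ ρ → proj₂ (∷-injective (eq ρ)))

-- Partiality

-- The partial identity defined only at true.
assert : Circuit 1 1
assert = (tt ⊗ id₁) ⨾ cocopy

assert-del : assert ⨾ del ≈ test₁
assert-del = assoc

-- By `frobeniusʳ`, asserting and then copying is copying and then asserting the first copy;
-- deleting that copy leaves the test.
assert≈copy-test : assert ≈ copy ⨾ (test₁ ⊗ id₁)
assert≈copy-test = begin
  assert                                                    ≈⟨ idʳ ⟨
  assert ⨾ id₁                                              ≈⟨ ⨾-congˡ (axiom copy-counitˡ) ⟨
  assert ⨾ (copy ⨾ (del ⊗ id₁))                             ≈⟨ assoc ⟨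
  (assert ⨾ copy) ⨾ (del ⊗ id₁)                             ≈⟨ ⨾-congʳ assert-copy ⟩
  (copy ⨾ (assert ⊗ id₁)) ⨾ (del ⊗ id₁)                     ≈⟨ assoc ⟩
  copy ⨾ ((assert ⊗ id₁) ⨾ (del ⊗ id₁))                     ≈⟨ ⨾-congˡ whiskerʳ ⟨
  copy ⨾ ((assert ⨾ del) ⊗ id₁)                             ≈⟨ ⨾-congˡ (⊗-congʳ assert-del) ⟩
  copy ⨾ (test₁ ⊗ id₁)                                      ∎
  where
  assert-copy : assert ⨾ copy ≈ copy ⨾ (assert ⊗ id₁)
  assert-copy = begin
    ((tt ⊗ id₁) ⨾ cocopy) ⨾ copy
      ≈⟨ ≈-trans assoc (⨾-congˡ (axiom frobeniusʳ)) ⟩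
    (tt ⊗ id₁) ⨾ ((id₁ ⊗ copy) ⨾ (cocopy ⊗ id₁))
      ≈⟨ ≈-trans (≈-sym assoc) (⨾-congʳ (≈-trans (≈-sym ⊗-splitˡ) ⊗-splitʳ)) ⟩
    ((id 0 ⊗ copy) ⨾ (tt ⊗ id 2)) ⨾ (cocopy ⊗ id₁)
      ≈⟨ ≈-trans assoc (⨾-cong unitˡ (⨾-cong (≈-sym ⊗-id-+) ≈-refl)) ⟩
    copy ⨾ (((tt ⊗ id₁) ⊗ id₁) ⨾ (cocopy ⊗ id₁))
      ≈⟨ ⨾-congˡ (≈-sym whiskerʳ) ⟩
    copy ⨾ (assert ⊗ id₁) ∎

-- By `frobeniusˡ`, `tt` is copied ahead of `cocopy`, so the first copy of the output is `tt`
-- itself; deleting the second leaves the test.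
assert≈test-tt : assert ≈ test₁ ⨾ tt
assert≈test-tt = begin
  assert                           ≈⟨ idʳ ⟨
  assert ⨾ id₁                     ≈⟨ ⨾-congˡ (axiom copy-counitʳ) ⟨
  assert ⨾ (copy ⨾ (id₁ ⊗ del))    ≈⟨ assoc ⟨
  (assert ⨾ copy) ⨾ (id₁ ⊗ del)    ≈⟨ ⨾-cong assert-copy ≈-refl ⟩
  (tt ⊗ assert) ⨾ (id₁ ⊗ del)      ≈⟨ interchange ⟩
  (tt ⨾ id₁) ⊗ (assert ⨾ del)      ≈⟨ ⊗-cong idʳ assert-del ⟩
  tt ⊗ test₁                       ≈⟨ ⊗-splitʳ ⟩
  (id 0 ⊗ test₁) ⨾ (tt ⊗ id 0)     ≈⟨ ⨾-cong unitˡ unitʳ ⟩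
  test₁ ⨾ tt                       ∎
  where
  assert-copy : assert ⨾ copy ≈ tt ⊗ assert
  assert-copy = begin
    ((tt ⊗ id₁) ⨾ cocopy) ⨾ copy
      ≈⟨ ≈-trans assoc (⨾-congˡ (≈-sym (axiom frobeniusˡ))) ⟩
    (tt ⊗ id₁) ⨾ ((copy ⊗ id₁) ⨾ (id₁ ⊗ cocopy))
      ≈⟨ assoc ⟨
    ((tt ⊗ id₁) ⨾ (copy ⊗ id₁)) ⨾ (id₁ ⊗ cocopy)
      ≈⟨ ⨾-congʳ (≈-trans (≈-sym whiskerʳ) (≈-trans (⊗-congʳ (axiom tt-copy)) ⊗-assoc≈)) ⟩
    (tt ⊗ (tt ⊗ id₁)) ⨾ (id₁ ⊗ cocopy)
      ≈⟨ ≈-trans interchange (⊗-congʳ idʳ) ⟩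
    tt ⊗ assert ∎

-- `tt ⊗ tt` is `tt ⨾ copy`, and `special` cancels `copy` against `cocopy`.
tt-test : tt ⨾ test₁ ≈ id 0
tt-test = begin
  tt ⨾ ((tt ⊗ id₁) ⨾ (cocopy ⨾ del))     ≈⟨ assoc ⟨
  (tt ⨾ (tt ⊗ id₁)) ⨾ (cocopy ⨾ del)     ≈⟨ ⨾-congʳ (≈-trans (⨾-congʳ (≈-sym unitˡ)) (≈-sym ⊗-splitʳ)) ⟩
  (tt ⊗ tt) ⨾ (cocopy ⨾ del)             ≈⟨ ⨾-congʳ (axiom tt-copy) ⟨
  (tt ⨾ copy) ⨾ (cocopy ⨾ del)           ≈⟨ ≈-trans assoc (⨾-congˡ (≈-sym assoc)) ⟩
  tt ⨾ ((copy ⨾ cocopy) ⨾ del)           ≈⟨ ⨾-congˡ (≈-trans (⨾-congʳ (axiom special)) idˡ) ⟩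
  tt ⨾ del                               ≈⟨ axiom tt-del ⟩
  id 0                                   ∎

conj : List (Exp k) → Exp k
conj = foldr _∧ᵉ_ trueᵉ

-- `∧-test` merges two tests into one; the empty list becomes the test of `tt`, which is trivial.
guard-conj : (qs : List (Exp k)) (f : Circuit k n) → guard qs f ≈ ⟨ circuit (conj qs) ⨾ test₁ , f ⟩
guard-conj {k} [] f = begin
  f                                      ≈⟨ ⟨⟩-unitˡ ⟨
  ⟨ discard k , f ⟩                      ≈⟨ ⟨⟩-congʳ (≈-trans assoc (≈-trans (⨾-congˡ tt-test) idʳ)) ⟨
  ⟨ (discard k ⨾ tt) ⨾ test₁ , f ⟩       ∎
guard-conj (q ∷ qs) f = begin
  ⟨ circuit q ⨾ test₁ , guard qs f ⟩
    ≈⟨ ⟨⟩-congˡ (guard-conj qs f) ⟩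
  ⟨ circuit q ⨾ test₁ , ⟨ circuit (conj qs) ⨾ test₁ , f ⟩ ⟩
    ≈⟨ ⟨⟩-assoc ⟨
  ⟨ ⟨ circuit q ⨾ test₁ , circuit (conj qs) ⨾ test₁ ⟩ , f ⟩
    ≈⟨ ⟨⟩-congʳ (≈-trans assoc (≈-trans (⨾-congˡ (axiom ∧-test)) ⟨⟩-⊗)) ⟨
  ⟨ circuit (q ∧ᵉ conj qs) ⨾ test₁ , f ⟩ ∎

-- A neutral `tt` is conjoined with `x`. By the two forms of `assert`, a test of `q` followed by
-- `tt` is a test of `q` that also outputs `q`, so this `tt` becomes `q`.
test-absorb : (q x : Exp k) →
              ⟨ circuit q ⨾ test₁ , circuit x ⟩ ≈ ⟨ circuit q ⨾ test₁ , circuit (q ∧ᵉ x) ⟩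
test-absorb q x = begin
  ⟨ circuit q ⨾ test₁ , circuit x ⟩
    ≈⟨ idʳ ⟨
  ⟨ circuit q ⨾ test₁ , circuit x ⟩ ⨾ id₁
    ≈⟨ ⨾-congˡ (axiom ∧-identityˡ) ⟨
  ⟨ circuit q ⨾ test₁ , circuit x ⟩ ⨾ ((tt ⊗ id₁) ⨾ ∧)
    ≈⟨ ≈-trans (≈-sym assoc) (⨾-congʳ ⟨⟩-⊗ˡ) ⟩
  ⟨ (circuit q ⨾ test₁) ⨾ tt , circuit x ⟩ ⨾ ∧
    ≈⟨ ⨾-congʳ (⟨⟩-congʳ test-tt) ⟩
  ⟨ ⟨ circuit q ⨾ test₁ , circuit q ⟩ , circuit x ⟩ ⨾ ∧
    ≈⟨ ⨾-cong ⟨⟩-assoc (≈-sym unitˡ) ⟩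
  ⟨ circuit q ⨾ test₁ , ⟨ circuit q , circuit x ⟩ ⟩ ⨾ (id 0 ⊗ ∧)
    ≈⟨ ⟨⟩-⊗ʳ ⟩
  ⟨ circuit q ⨾ test₁ , circuit (q ∧ᵉ x) ⟩ ∎
  where
  test-tt : (circuit q ⨾ test₁) ⨾ tt ≈ ⟨ circuit q ⨾ test₁ , circuit q ⟩
  test-tt = begin
    (circuit q ⨾ test₁) ⨾ tt                    ≈⟨ assoc ⟩
    circuit q ⨾ (test₁ ⨾ tt)                    ≈⟨ ⨾-congˡ assert≈test-tt ⟨
    circuit q ⨾ assert                          ≈⟨ ⨾-congˡ assert≈copy-test ⟩
    circuit q ⨾ (copy ⨾ (test₁ ⊗ id₁))          ≈⟨ assoc ⟨
    (circuit q ⨾ copy) ⨾ (test₁ ⊗ id₁)          ≈⟨ ⨾-congʳ (circuit-copyable q) ⟩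
    ⟨ circuit q , circuit q ⟩ ⨾ (test₁ ⊗ id₁)   ≈⟨ ⟨⟩-⊗ˡ ⟩
    ⟨ circuit q ⨾ test₁ , circuit q ⟩           ∎

test-absorb-tuple : (q : Exp k) (xs : Vec (Exp k) n) →
                    ⟨ circuit q ⨾ test₁ , tuple xs ⟩ ≈ ⟨ circuit q ⨾ test₁ , tuple (map (q ∧ᵉ_) xs) ⟩
test-absorb-tuple q []       = ≈-refl
test-absorb-tuple q (x ∷ xs) = begin
  -- The test first moves inward to mask the tail, then back out to mask the head.
  ⟨ t , ⟨ circuit x , tuple xs ⟩ ⟩         ≈⟨ ⟨⟩-effect-shift _ _ _ ⟨
  ⟨ circuit x , ⟨ t , tuple xs ⟩ ⟩         ≈⟨ ⟨⟩-congˡ (test-absorb-tuple q xs) ⟩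
  ⟨ circuit x , ⟨ t , tuple xs′ ⟩ ⟩        ≈⟨ ⟨⟩-effect-shift _ _ _ ⟩
  ⟨ t , ⟨ circuit x , tuple xs′ ⟩ ⟩        ≈⟨ ⟨⟩-assoc ⟨
  ⟨ ⟨ t , circuit x ⟩ , tuple xs′ ⟩        ≈⟨ ⟨⟩-congʳ (test-absorb q x) ⟩
  ⟨ ⟨ t , circuit (q ∧ᵉ x) ⟩ , tuple xs′ ⟩ ≈⟨ ⟨⟩-assoc ⟩
  ⟨ t , ⟨ circuit (q ∧ᵉ x) , tuple xs′ ⟩ ⟩ ∎
  where
  t   = circuit q ⨾ test₁
  xs′ = map (q ∧ᵉ_) xs

-- Where the condition holds the mask changes nothing; where it fails all outputs become false, so
-- the semantics fixes the outputs at every input.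
normalise : Result k m → Exp k × Vec (Exp k) m
normalise (qs , xs) = conj qs , map (conj qs ∧ᵉ_) xs

denote-normalise : (r : Result k m) → let q , xs = normalise r in
                   denote r ≈ ⟨ circuit q ⨾ test₁ , tuple xs ⟩
denote-normalise (qs , xs) = ≈-trans (guard-conj qs (tuple xs)) (test-absorb-tuple (conj qs) xs)

-- Semantics of results and completeness

outcome : Vec Bool k → Result k m → Maybe (Vec Bool m)
outcome ρ (qs , xs) = if eval ρ (conj qs) then just (map (eval ρ) xs) else nothing

eval-conj-++ : ∀ ρ (qs rs : List (Exp k)) →
               eval ρ (conj (qs ++ˡ rs)) ≡ eval ρ (conj qs) ∧ᵇ eval ρ (conj rs)
eval-conj-++ ρ []       rs = refl
eval-conj-++ ρ (q ∷ qs) rs =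
  trans (cong (eval ρ q ∧ᵇ_) (eval-conj-++ ρ qs rs)) (sym (∧ᵇ-assoc (eval ρ q) _ _))

-- The semantic counterpart of `run-sound`, by the same induction: a composite is defined exactly
-- when the conditions of both parts hold.
run-eval : (c : Circuit n m) (ρ : Vec Bool k) (xs : Vec (Exp k) n) →
           ⟦ c ⟧ (map (eval ρ) xs) ≡ outcome ρ (run c xs)
run-eval (gen ∧ᵍ)    ρ (x ∷ y ∷ []) = refl
run-eval (gen ¬ᵍ)    ρ (x ∷ [])     = refl
run-eval (gen ttᵍ)   ρ []           = refl
run-eval (gen copyᵍ) ρ (x ∷ [])     = refl
run-eval (gen delᵍ)  ρ (x ∷ [])     = refl
run-eval (gen cocopyᵍ) ρ (x ∷ y ∷ []) with eval ρ x | eval ρ y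
... | true  | true  = refl
... | true  | false = refl
... | false | true  = refl
... | false | false = refl
run-eval (id n) ρ xs           = refl
run-eval σ      ρ (x ∷ y ∷ []) = refl
run-eval (c ⨾ d) ρ xs
  rewrite run-eval c ρ xs
        | eval-conj-++ ρ (proj₁ (run c xs)) (proj₁ (run d (proj₂ (run c xs))))
  with eval ρ (conj (proj₁ (run c xs)))
... | true  = run-eval d ρ (proj₂ (run c xs))
... | false = refl
run-eval (_⊗_ {n = n} c d) ρ xs
  rewrite take-map (eval ρ) n xs | drop-map (eval ρ) n xs
        | run-eval c ρ (take n xs) | run-eval d ρ (drop n xs)
        | eval-conj-++ ρ (proj₁ (run c (take n xs))) (proj₁ (run d (drop n xs)))
  with eval ρ (conj (proj₁ (run c (take n xs)))) | eval ρ (conj (proj₁ (run d (drop n xs))))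
... | true  | true  = cong just (sym (map-++ (eval ρ) (proj₂ (run c (take n xs))) _))
... | true  | false = refl
... | false | _     = refl

-- Masking the outputs by p makes them comparable even where the outcome is undefined.
if-just-injective : ∀ p q (v w : Vec Bool n) →
                    (if p then just v else nothing) ≡ (if q then just w else nothing) →
                    p ≡ q × map (p ∧ᵇ_) v ≡ map (q ∧ᵇ_) w
if-just-injective true  true  v w refl = refl , refl
if-just-injective false false v w eq   =
  refl , trans (map-const v false) (sym (map-const w false))

outcome-normalise : ∀ ρ (r s : Result k m) → outcome ρ r ≡ outcome ρ s →
                    let q , xs = normalise r ; p , ys = normalise s in
                    eval ρ q ≡ eval ρ p × map (eval ρ) xs ≡ map (eval ρ) ys
outcome-normalise ρ (qs , xs) (rs , ys) eq
  with p , v ← if-just-injective (eval ρ (conj qs)) (eval ρ (conj rs)) _ _ eq =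
  p , trans (masked qs xs) (trans v (sym (masked rs ys)))
  where
  -- Both sides fuse to one `map` of the same function, since `eval` computes on conjunctions.
  masked : ∀ qs xs → map (eval ρ) (map (conj qs ∧ᵉ_) xs) ≡ map (eval ρ (conj qs) ∧ᵇ_) (map (eval ρ) xs)
  masked qs xs = trans (sym (map-∘ (eval ρ) (conj qs ∧ᵉ_) xs)) (map-∘ (eval ρ (conj qs) ∧ᵇ_) (eval ρ) xs)

-- Both results are normalised first, because their raw outputs may differ at inputs where the
-- conditions fail.
denote-complete : (r s : Result k m) → (∀ ρ → outcome ρ r ≡ outcome ρ s) → denote r ≈ denote s
denote-complete r s eq = begin
  denote r
    ≈⟨ denote-normalise r ⟩
  ⟨ circuit p ⨾ test₁ , tuple xs ⟩
    ≈⟨ ⟨⟩-cong (⨾-congʳ (sound (exp-complete p q λ ρ → proj₁ (outcome-normalise ρ r s (eq ρ)))))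
               (tuple-complete xs ys λ ρ → proj₂ (outcome-normalise ρ r s (eq ρ))) ⟩
  ⟨ circuit q ⨾ test₁ , tuple ys ⟩
    ≈⟨ denote-normalise s ⟨
  denote s ∎
  where
  p  = proj₁ (normalise r)
  q  = proj₁ (normalise s)
  xs = proj₂ (normalise r)
  ys = proj₂ (normalise s)

run-variables : (c : Circuit n m) → c ≈ denote (run c (variables n))
run-variables {n} c = begin
  c                              ≈⟨ idˡ ⟨
  id n ⨾ c                       ≈⟨ ⨾-congʳ (tuple-variables n) ⟨
  tuple (variables n) ⨾ c        ≈⟨ run-sound c (variables n) ⟩
  denote (run c (variables n))   ∎

theorem9 : ∀ (n m : ℕ) (c d : Circuit n m) → ⟦ c ⟧ ≗ ⟦ d ⟧ → c =ℙ𝔹 d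
theorem9 n m c d eq = begin
  c                              ≈⟨ run-variables c ⟩
  denote (run c (variables n))   ≈⟨ denote-complete _ _ outcomes ⟩
  denote (run d (variables n))   ≈⟨ run-variables d ⟨
  d                              ∎
  where
  outcomes : ∀ ρ → outcome ρ (run c (variables n)) ≡ outcome ρ (run d (variables n))
  outcomes ρ = trans (sym (run-eval c ρ (variables n)))
                 -- The hypothesis is used at the input `map (eval ρ) (variables n)`.
                 (trans (eq _) (run-eval d ρ (variables n)))
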